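{- Let $f_{3,+},f_{6,- }\in\mathbb{Q}[x_1,x_2,x_3]$ be the polynomials $$f_{3,+}(x)=-(-x_1+x_2+x_3)(x_1-x_2+x_3)(x_1+x_2-x_3),\qquad f_{6,- }(x)=x_1x_2x_3(x_1-x_2)(x_2-x_3)(x_3-x_1).$$ Then: (1) When $l$ is odd, every polynomial in $\mathcal{H}_l^\Gamma$ is divisible by $f_{3,+}$. (2) For every $l$, every polynomial in $\mathcal{H}_{l,- }^\Gamma$ is divisible by $f_{6,- }$.
   Context: Let $D=\mathbb{Q}+\mathbb{Q}i+\mathbb{Q}j+\mathbb{Q}ij$ be the quaternion algebra over $\mathbb{Q}$ with $i^2=j^2=-1$, $ij=-ji$, with involution $\iota(a_0+a_1i+a_2j+a_3ij)=a_0-a_1i-a_2j-a_3ij$, $\mathrm{Tr}(x)=x+\iota(x)$, $\mathrm{Nm}(x)=x\,\iota(x)$. Let $\mathcal{O}=\mathbb{Z}+\mathbb{Z}i+\mathbb{Z}j+\mathbb{Z}w$ with $w=(1+i+j+ij)/2$ (the Hurwitz maximal order). Let $V_D=\{x\in D\mid \mathrm{Tr}(x)=0\}$, with basis $\mathbf{b}_1=-i+j+ij$, $\mathbf{b}_2=i-j+ij$, $\mathbf{b}_3=i+j-ij$; identify $x_1\mathbf{b}_1+x_2\mathbf{b}_2+x_3\mathbf{b}_3\in V_D$ with the row vector $x=(x_1,x_2,x_3)$. For $g\in D^\times$ let $\mathcal{F}(g)\in\mathrm{SL}_3(\mathbb{Q})$ be the matrix such that the map $x\mapsto g^{ -1}xg$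 on $V_D$ is $x\mapsto x\,\mathcal{F}(g)$ on row vectors. Put $\Gamma=\mathcal{F}(\mathcal{O}^\times)$, a finite group of order $12$. For $l\ge 0$ let $\mathcal{A}_l$ be the $\mathbb{Q}$-space of homogeneous polynomials of degree $l$ in $\mathbb{Q}[x_1,x_2,x_3]$ (including $0$), let $\Delta_Q=\frac12\left(\frac{\partial^2}{\partial x_1^2}+\frac{\partial^2}{\partial x_2^2}+\frac{\partial^2}{\partial x_3^2}+\frac{\partial^2}{\partial x_1\partial x_2}+\frac{\partial^2}{\partial x_2\partial x_3}+\frac{\partial^2}{\partial x_3\partial x_1}\right)$, let $\mathcal{H}_l=\{f\in\mathcal{A}_l\mid\Delta_Qf=0\}$, and let $\mathcal{H}_l^\Gamma=\{f\in\mathcal{H}_l\mid f(x\gamma)=f(x)\ \forall\gamma\in\Gamma\}$. Let $\mathfrak{T}_2=\{\mathcal{F}(y)\mid y\in\mathcal{O},\ \mathrm{Nm}(y)=2\}$ and define $T_2$ on $\mathcal{H}_l^\Gamma$ by $(T_2f)(x)=\sum_{\gamma\in\Gamma\backslash\mathfrak{T}_2}f(x\gamma^{ -1})$. Set $\mathcal{H}_{l,- }^\Gamma=\{f\in\mathcal{H}_l^\Gamma\mid T_2f=-(-1)^lf\}$. Divisibility is in the polynomial ring $\mathbb{Q}[x_1,x_2,x_3]$. -}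

module Defs where

open import Algebra.Bundles.Raw using (RawRing)
import Algebra.Definitions as AlgebraDefinitions
import Algebra.Definitions.RawSemiring as RawSemiringDefinitions
open import Data.Bool.Base using (if_then_else_)
open import Data.Fin.Base using (Fin)
open import Data.Fin.Patterns using (0F; 1F; 2F)
import Data.Fin.Properties as Fin
open import Data.Integer.Base using (ℤ; +_)
open import Data.List.Base as List using (List; []; _∷_; _++_)
open import Data.List.Relation.Unary.All using (All)
open import Data.List.Relation.Unary.AllPairs using (AllPairs)
open import Data.List.Relation.Unary.Any using (Any)
open import Data.Nat.Base as ℕ using (ℕ)
import Data.Nat.Properties as ℕ
open import Data.Product.Base using (Σ; _×_; _,_; ∃-syntax)
open import Data.Rational.Base as ℚ using (ℚ; 0ℚ; 1ℚ; ½)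
import Data.Rational.Properties as ℚ
open import Data.Vec.Base as Vec using (Vec)
import Data.Vec.Properties as Vec
open import Data.Vec.Functional using (Vector)
open import Level using (0ℓ)
open import Relation.Binary.Core using (Rel)
open import Relation.Binary.Definitions using (DecidableEquality)
open import Relation.Binary.PropositionalEquality.Core using (_≡_; _≢_)
open import Relation.Nullary.Decidable.Core using (does)
open import Relation.Nullary.Negation.Core using (¬_)
open import Relation.Unary using (Pred)

module ℚ-Semiring = RawSemiringDefinitions (RawRing.rawSemiring ℚ.+-*-rawRing)

ℤ→ℚ : ℤ → ℚ
ℤ→ℚ n = n ℚ./ 1

------------------------------------------------------------------------
-- Matrices acting on row vectors

Row : Set
Row = Vector ℚ 3

Matrix : Set
Matrix = Fin 3 → Fin 3 → ℚ

infix 4 _≐_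
_≐_ : Rel Matrix 0ℓ
A ≐ B = ∀ i j → A i j ≡ B i j

I₃ : Matrix
I₃ i j = if does (i Fin.≟ j) then 1ℚ else 0ℚ

infixl 7 _ᵣ·_ _·_

_ᵣ·_ : Row → Matrix → Row
(x ᵣ· A) j = ℚ-Semiring.sum λ i → x i ℚ.* A i j

_·_ : Matrix → Matrix → Matrix
(A · B) i = A i ᵣ· B

GL₃ : Set
GL₃ = Σ Matrix (AlgebraDefinitions.Invertible _≐_ I₃ _·_)

matrix inverse : GL₃ → Matrix
matrix  (A , _)       = A
inverse (_ , A⁻¹ , _) = A⁻¹

------------------------------------------------------------------------
-- Hamilton quaternions over ℚ

module Quaternion where

  infixl 6 _+_
  infixl 7 _*_

  -- quat a₀ a₁ a₂ a₃ is a₀ + a₁ i + a₂ j + a₃ ij.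
  record D : Set where
    constructor quat
    field a₀ a₁ a₂ a₃ : ℚ

  1# i j ij : D
  1# = quat 1ℚ 0ℚ 0ℚ 0ℚ
  i  = quat 0ℚ 1ℚ 0ℚ 0ℚ
  j  = quat 0ℚ 0ℚ 1ℚ 0ℚ
  ij = quat 0ℚ 0ℚ 0ℚ 1ℚ

  _+_ _*_ : D → D → D
  quat a₀ a₁ a₂ a₃ + quat b₀ b₁ b₂ b₃ =
    quat (a₀ ℚ.+ b₀) (a₁ ℚ.+ b₁) (a₂ ℚ.+ b₂) (a₃ ℚ.+ b₃)
  quat a₀ a₁ a₂ a₃ * quat b₀ b₁ b₂ b₃ = quat
    (a₀ ℚ.* b₀ ℚ.- a₁ ℚ.* b₁ ℚ.- a₂ ℚ.* b₂ ℚ.- a₃ ℚ.* b₃)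
    (a₀ ℚ.* b₁ ℚ.+ a₁ ℚ.* b₀ ℚ.+ a₂ ℚ.* b₃ ℚ.- a₃ ℚ.* b₂)
    (a₀ ℚ.* b₂ ℚ.- a₁ ℚ.* b₃ ℚ.+ a₂ ℚ.* b₀ ℚ.+ a₃ ℚ.* b₁)
    (a₀ ℚ.* b₃ ℚ.+ a₁ ℚ.* b₂ ℚ.- a₂ ℚ.* b₁ ℚ.+ a₃ ℚ.* b₀)

  scalar : ℚ → D
  scalar q = quat q 0ℚ 0ℚ 0ℚ

  ι Nm : D → D
  ι (quat a₀ a₁ a₂ a₃) = quat a₀ (ℚ.- a₁) (ℚ.- a₂) (ℚ.- a₃)
  Nm x = x * ι x

  w : D
  w = scalar ½ * (1# + i + j + ij)

  𝒪 : Pred D 0ℓ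
  𝒪 x = ∃[ a ] ∃[ b ] ∃[ c ] ∃[ d ]
    x ≡ scalar (ℤ→ℚ a) + scalar (ℤ→ℚ b) * i + scalar (ℤ→ℚ c) * j + scalar (ℤ→ℚ d) * w

  Dˣ : Set
  Dˣ = Σ D (AlgebraDefinitions.Invertible _≡_ 1# _*_)

  value inv : Dˣ → D
  value (g , _)       = g
  inv   (_ , g⁻¹ , _) = g⁻¹

  𝒪ˣ : Pred Dˣ 0ℓ
  𝒪ˣ u = 𝒪 (value u) × 𝒪 (inv u)

  -- A basis of the trace-zero quaternions V_D.
  𝐛 : Fin 3 → D
  𝐛 0F = scalar (ℚ.- 1ℚ) * i + j + ij
  𝐛 1F = i + scalar (ℚ.- 1ℚ) * j + ij
  𝐛 2F = i + j + scalar (ℚ.- 1ℚ) * ij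

  -- The identification of ℚ³ with V_D.
  fromRow : Row → D
  fromRow x = scalar (x 0F) * 𝐛 0F + scalar (x 1F) * 𝐛 1F + scalar (x 2F) * 𝐛 2F

  -- A ≐𝓕 g says that A is the matrix 𝓕(g) of conjugation x ↦ g⁻¹xg on V_D;
  -- since 𝐛 is a basis of V_D, each g has exactly one such A.
  infix 4 _≐𝓕_
  _≐𝓕_ : Matrix → Dˣ → Set
  A ≐𝓕 g = ∀ x → fromRow (x ᵣ· A) ≡ inv g * fromRow x * value g

  Γ : Pred Matrix 0ℓ
  Γ A = ∃[ u ] 𝒪ˣ u × A ≐𝓕 u

  -- An element of norm 2 is invertible, so quantifying over Dˣ loses nothing.
  𝔗₂ : Pred Matrix 0ℓ
  𝔗₂ A = ∃[ y ] 𝒪 (value y) × Nm (value y) ≡ scalar (ℤ→ℚ (+ 2)) × A ≐𝓕 y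

open Quaternion public using (Γ; 𝔗₂)

------------------------------------------------------------------------
-- Complete systems of representatives of H\S

record Transversal (H S : Pred Matrix 0ℓ) : Set where
  _∼_ : Rel Matrix 0ℓ
  A ∼ B = ∃[ δ ] H δ × A ≐ δ · B

  field
    representatives : List GL₃
    in-S            : All (λ ρ → S (matrix ρ)) representatives
    complete        : ∀ A → S A → Any (λ ρ → A ∼ matrix ρ) representatives
    distinct        : AllPairs (λ ρ ρ′ → ¬ (matrix ρ ∼ matrix ρ′)) representatives

------------------------------------------------------------------------
-- The polynomial ring ℚ[x₁, x₂, x₃]

module Polynomial where

  Exponent : Set
  Exponent = Vec ℕ 3

  _≟ᴱ_ : DecidableEquality Exponent
  _≟ᴱ_ = Vec.≡-dec ℕ._≟_

  -- (c , e) stands for c x₁^e₁ x₂^e₂ x₃^e₃, and a list for the sum of its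
  -- terms. An exponent may occur repeatedly; _≈_ compares total coefficients.
  Poly : Set
  Poly = List (ℚ × Exponent)

  coeff : Poly → Exponent → ℚ
  coeff []            e = 0ℚ
  coeff ((c , d) ∷ f) e = if does (d ≟ᴱ e) then c ℚ.+ coeff f e else coeff f e

  infix 4 _≈_
  _≈_ : Rel Poly 0ℓ
  f ≈ g = ∀ e → coeff f e ≡ coeff g e

  infixl 6 _+_ _-_
  infixl 7 _*_
  infix  8 -_

  C : ℚ → Poly
  C c = (c , Vec.replicate 3 0) ∷ []

  X : Fin 3 → Poly
  X k = (1ℚ , Vec.updateAt (Vec.replicate 3 0) k ℕ.suc) ∷ []

  _+_ _*_ : Poly → Poly → Poly
  _+_ = _++_
  _*_ = List.cartesianProductWith
    (λ (c , d) (c′ , d′) → c ℚ.* c′ , Vec.zipWith ℕ._+_ d d′)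

  -_ : Poly → Poly
  -_ = List.map (λ (c , d) → ℚ.- c , d)

  _-_ : Poly → Poly → Poly
  f - g = f + (- g)

  rawRing : RawRing 0ℓ 0ℓ
  rawRing = record
    { Carrier = Poly
    ; _≈_     = _≈_
    ; _+_     = _+_
    ; _*_     = _*_
    ; -_      = -_
    ; 0#      = []
    ; 1#      = C 1ℚ
    }

  open RawSemiringDefinitions (RawRing.rawSemiring rawRing) public
    using (_∣_; _^_; sum; product)

  ∂ : Fin 3 → Poly → Poly
  ∂ k = List.map λ (c , d) →
    ℤ→ℚ (+ Vec.lookup d k) ℚ.* c , Vec.updateAt d k ℕ.pred

  substitute : (Fin 3 → Poly) → Poly → Poly
  substitute p = List.foldr
    (λ (c , d) g → C c * product (λ k → p k ^ Vec.lookup d k) + g) []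

  -- f ∘ᴹ A is f(xA).
  _∘ᴹ_ : Poly → Matrix → Poly
  f ∘ᴹ A = substitute (λ k → sum λ m → X m * C (A m k)) f

  𝒜 : ℕ → Pred Poly 0ℓ
  𝒜 l f = ∀ e → coeff f e ≢ 0ℚ → Vec.sum e ≡ l

  Δ_Q : Poly → Poly
  Δ_Q f = C ½ *
    ( ∂ 0F (∂ 0F f) + ∂ 1F (∂ 1F f) + ∂ 2F (∂ 2F f)
    + ∂ 0F (∂ 1F f) + ∂ 1F (∂ 2F f) + ∂ 2F (∂ 0F f))

  ℋ : ℕ → Pred Poly 0ℓ
  ℋ l f = 𝒜 l f × Δ_Q f ≈ []

  ℋ^Γ : ℕ → Pred Poly 0ℓ
  ℋ^Γ l f = ℋ l f × (∀ γ → Γ γ → f ∘ᴹ γ ≈ f)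

  -- On Γ-invariant f this does not depend, up to _≈_, on the transversal.
  T₂ : Transversal Γ 𝔗₂ → Poly → Poly
  T₂ R f = List.foldr (λ γ g → f ∘ᴹ inverse γ + g) [] (Transversal.representatives R)

  ℋ^Γ₋ : Transversal Γ 𝔗₂ → ℕ → Pred Poly 0ℓ
  ℋ^Γ₋ R l f = ℋ^Γ l f × T₂ R f ≈ - ((- C 1ℚ) ^ l * f)

  f₃₊ f₆₋ : Poly
  f₃₊ = - ((- X 0F + X 1F + X 2F) * (X 0F - X 1F + X 2F) * (X 0F + X 1F - X 2F))
  f₆₋ = X 0F * X 1F * X 2F * (X 0F - X 1F) * (X 1F - X 2F) * (X 2F - X 0F)

{-# OPTIONS --safe #-}

-- If a homogeneous f of degree l is invariant under a matrix acting as −1 on a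
-- plane L = 0, then its restriction to that plane is multiplied by (−1)ˡ. For l
-- odd it therefore vanishes, so L divides f. The units i, j and ij act in this
-- way on the three planes whose linear forms are the factors of f₃₊.
--
-- All elements of 𝒪 of norm 2 lie in the coset 𝒪ˣ(1 + i), so composing T₂ f with
-- A₀ = 𝓕(1 + i) gives n f, where n is the number of representatives. The
-- elements i ± j, i ± ij and j ± ij are multiples of 1 + i by a unit and act as −1
-- on the six planes whose linear forms are the factors of f₆₋. On such a plane
-- T₂ f = −(−1)ˡ f becomes n f = − f, and f vanishes there since n + 1 ≠ 0.
--
-- The factors are divided out one by one: each new form divides the last
-- quotient because the product of the earlier forms is regular on its plane.
module Submission where

open import Algebra.Bundles using (CommutativeRing)
import Algebra.Properties.Ring as RingProperties
open import Data.Bool.Base using (if_then_else_)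
open import Data.Fin using (Fin; #_)
open import Data.Fin.Patterns using (0F; 1F; 2F)
import Data.Fin.Properties as Fin
open import Data.Integer.Base as ℤ using (ℤ; +_; -[1+_]; 0ℤ; 1ℤ; -1ℤ)
open import Data.Integer.DivMod using (_%ℕ_; _/ℕ_; a≡a%ℕn+[a/ℕn]*n; n%ℕd<d)
import Data.Integer.Properties as ℤ
import Data.Integer.Tactic.RingSolver as ℤ
open import Data.List.Base as List using (List; []; _∷_)
import Data.List.Properties as List
open import Data.List.Relation.Unary.All as All using (All; []; _∷_; all?)
open import Data.List.Relation.Unary.Any using (Any; here; there)
open import Data.Maybe.Base using (nothing)
open import Data.Nat.Base as ℕ using (ℕ; zero; suc; _≤_; z≤n; s≤s)
import Data.Nat.Properties as ℕ
open import Data.Product.Base using (_×_; _,_; proj₁; proj₂; ∃-syntax)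
open import Data.Rational.Base as ℚ using (ℚ; 0ℚ; 1ℚ; ½; toℚᵘ)
import Data.Rational.Properties as ℚ
open import Data.Rational.Solver using (module +-*-Solver)
import Data.Rational.Unnormalised.Base as ℚᵘ
import Data.Rational.Unnormalised.Properties as ℚᵘ
open import Data.Sum.Base using (_⊎_; inj₁; inj₂)
open import Data.Vec.Base as Vec using (Vec; []; _∷_)
import Data.Vec.Properties as Vec
open import Function.Base using (_∘_)
open import Level using (0ℓ)
open import Relation.Binary.Definitions using (Decidable)
open import Relation.Binary.PropositionalEquality
import Relation.Binary.Reasoning.Setoid as SetoidReasoning
open import Relation.Nullary.Decidable using (Dec; yes; no; map′; does; True; toWitness)
open import Relation.Nullary.Negation.Core using (contradiction)
open import Tactic.RingSolver using (solve-∀)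
open import Tactic.RingSolver.Core.AlmostCommutativeRing using (AlmostCommutativeRing; fromCommutativeRing)

open import Defs
open +-*-Solver using (var; con; ⟦_⟧; ⟦_⟧↓; prove; solve; _:=_; _:+_; _:*_; _:-_; :-_)

-- Conjugation by a trace-zero quaternion g fixes g and negates its orthogonal complement in V_D.
-- The coefficients of i, j and ij in the quaternion with coordinates x are -x₁+x₂+x₃, x₁-x₂+x₃ and
-- x₁+x₂-x₃, the factors of f₃₊. Their pairwise sums and differences are, up to sign and a factor 2,
-- the six factors of f₆₋. So each factor cuts out the complement of one of the elements named
-- above. As 1 + i has trace 2, A₀ itself is a quarter-turn. Invariance under Γ allows A₀ to be
-- replaced by A₀γ with γ = 𝓕(u), where the unit u makes (1 + i)u trace-zero. Polynomials are lists
-- in which exponents may repeat and cancel, `_≈_` compares coefficients, and `substitute` works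
-- term by term. The algebra is therefore done in the equivalent relation `_≋_`, where the ring laws
-- and the laws of substitution become identities in ℚ.

-- Parity of the Hurwitz norm form

parity : ∀ n → ∃[ m ] (n ≡ m ℤ.+ m ⊎ n ≡ 1ℤ ℤ.+ (m ℤ.+ m))
parity n = n /ℕ 2 , cases (n %ℕ 2) (n%ℕd<d n 2) (a≡a%ℕn+[a/ℕn]*n n 2)
  where
  double : ∀ m → m ℤ.* + 2 ≡ m ℤ.+ m
  double = ℤ.solve-∀

  cases : ∀ r → r ℕ.< 2 → n ≡ + r ℤ.+ (n /ℕ 2) ℤ.* + 2 →
    n ≡ n /ℕ 2 ℤ.+ n /ℕ 2 ⊎ n ≡ 1ℤ ℤ.+ (n /ℕ 2 ℤ.+ n /ℕ 2)
  cases 0 _ eq = inj₁ (trans eq (trans (ℤ.+-identityˡ _) (double (n /ℕ 2))))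
  cases 1 _ eq = inj₂ (trans eq (cong (ℤ._+_ 1ℤ) (double (n /ℕ 2))))
  cases (suc (suc r)) (s≤s (s≤s ()))

double≢1 : ∀ n → n ℤ.+ n ≢ 1ℤ
double≢1 (+ zero)    ()
double≢1 (+ (suc n)) eq with ℕ.+-suc n n | ℤ.+-injective eq
  where import Data.Nat.Properties as ℕ
... | p | q = contradiction (trans (sym p) (cong ℕ.pred q)) λ ()
double≢1 -[1+ n ]    ()

-- Squaring is the identity modulo 2; this makes the squares in the norm form linear.
square-parity : ∀ n → ∃[ t ] n ℤ.* n ≡ n ℤ.+ (t ℤ.+ t)
square-parity n with parity n
... | m , inj₁ refl = ℤ.- m ℤ.+ (m ℤ.* m ℤ.+ m ℤ.* m) , identity m
  where
  identity : ∀ m → (m ℤ.+ m) ℤ.* (m ℤ.+ m) ≡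
    (m ℤ.+ m) ℤ.+ ((ℤ.- m ℤ.+ (m ℤ.* m ℤ.+ m ℤ.* m)) ℤ.+ (ℤ.- m ℤ.+ (m ℤ.* m ℤ.+ m ℤ.* m)))
  identity = ℤ.solve-∀
... | m , inj₂ refl = m ℤ.+ (m ℤ.* m ℤ.+ m ℤ.* m) , identity m
  where
  identity : ∀ m → (1ℤ ℤ.+ (m ℤ.+ m)) ℤ.* (1ℤ ℤ.+ (m ℤ.+ m)) ≡
    (1ℤ ℤ.+ (m ℤ.+ m)) ℤ.+ ((m ℤ.+ (m ℤ.* m ℤ.+ m ℤ.* m)) ℤ.+ (m ℤ.+ (m ℤ.* m ℤ.+ m ℤ.* m)))
  identity = ℤ.solve-∀

-- The hypothesis says that (1 + p)(1 + q) is odd.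
even-factor : ∀ p q t → p ℤ.+ q ℤ.+ p ℤ.* q ℤ.+ (t ℤ.+ t) ≡ + 2 → ∃[ m ] p ≡ m ℤ.+ m
even-factor p q t eq with parity p
... | m , inj₁ p≡2m = m , p≡2m
... | m , inj₂ refl = contradiction (trans (identity m q t) (cong (ℤ._- 1ℤ) eq))
                        (double≢1 (m ℤ.+ q ℤ.+ m ℤ.* q ℤ.+ t))
  where
  identity : ∀ m q t → (m ℤ.+ q ℤ.+ m ℤ.* q ℤ.+ t) ℤ.+ (m ℤ.+ q ℤ.+ m ℤ.* q ℤ.+ t) ≡
    1ℤ ℤ.+ (m ℤ.+ m) ℤ.+ q ℤ.+ (1ℤ ℤ.+ (m ℤ.+ m)) ℤ.* q ℤ.+ (t ℤ.+ t) ℤ.- 1ℤ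
  identity = ℤ.solve-∀

-- The norm of a + bi + cj + dw. All coordinates of w are 1/2, so w has norm 1 and its cross terms
-- with 1, i and j add up to d(a + b + c).
normForm : ℤ → ℤ → ℤ → ℤ → ℤ
normForm a b c d = a ℤ.* a ℤ.+ b ℤ.* b ℤ.+ c ℤ.* c ℤ.+ d ℤ.* d ℤ.+ d ℤ.* (a ℤ.+ b ℤ.+ c)

-- Modulo 2, with p = a + b + c, the norm form is p + d + pd = (1 + p)(1 + d) - 1. It is even only
-- if both 1 + p and 1 + d are odd.
normForm≡2⇒even : ∀ a b c d → normForm a b c d ≡ + 2 →
  ∃[ s ] ∃[ e ] a ℤ.+ b ℤ.+ c ≡ s ℤ.+ s × d ≡ e ℤ.+ e
normForm≡2⇒even a b c d eq
  with ta , a² ← square-parity a | tb , b² ← square-parity b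
     | tc , c² ← square-parity c | td , d² ← square-parity d
  = let s , a+b+c≡2s = even-factor (a ℤ.+ b ℤ.+ c) d t (trans (sym (left a b c d ta tb tc td)) eq′)
        e , d≡2e     = even-factor d (a ℤ.+ b ℤ.+ c) t (trans (sym (right a b c d ta tb tc td)) eq′)
    in s , e , a+b+c≡2s , d≡2e
  where
  t = ta ℤ.+ tb ℤ.+ tc ℤ.+ td

  eq′ : (a ℤ.+ (ta ℤ.+ ta)) ℤ.+ (b ℤ.+ (tb ℤ.+ tb)) ℤ.+ (c ℤ.+ (tc ℤ.+ tc)) ℤ.+ (d ℤ.+ (td ℤ.+ td))
    ℤ.+ d ℤ.* (a ℤ.+ b ℤ.+ c) ≡ + 2
  eq′ = trans (sym (cong₂ (λ x y → x ℤ.+ y ℤ.+ d ℤ.* (a ℤ.+ b ℤ.+ c))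
    (cong₂ ℤ._+_ (cong₂ ℤ._+_ a² b²) c²) d²)) eq

  left : ∀ a b c d x y z w → (a ℤ.+ (x ℤ.+ x)) ℤ.+ (b ℤ.+ (y ℤ.+ y)) ℤ.+ (c ℤ.+ (z ℤ.+ z)) ℤ.+ (d ℤ.+ (w ℤ.+ w))
    ℤ.+ d ℤ.* (a ℤ.+ b ℤ.+ c) ≡ (a ℤ.+ b ℤ.+ c) ℤ.+ d ℤ.+ (a ℤ.+ b ℤ.+ c) ℤ.* d
      ℤ.+ ((x ℤ.+ y ℤ.+ z ℤ.+ w) ℤ.+ (x ℤ.+ y ℤ.+ z ℤ.+ w))
  left = ℤ.solve-∀

  right : ∀ a b c d x y z w → (a ℤ.+ (x ℤ.+ x)) ℤ.+ (b ℤ.+ (y ℤ.+ y)) ℤ.+ (c ℤ.+ (z ℤ.+ z)) ℤ.+ (d ℤ.+ (w ℤ.+ w))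
    ℤ.+ d ℤ.* (a ℤ.+ b ℤ.+ c) ≡ d ℤ.+ (a ℤ.+ b ℤ.+ c) ℤ.+ d ℤ.* (a ℤ.+ b ℤ.+ c)
      ℤ.+ ((x ℤ.+ y ℤ.+ z ℤ.+ w) ℤ.+ (x ℤ.+ y ℤ.+ z ℤ.+ w))
  right = ℤ.solve-∀

-- The embedding of ℤ in ℚ

-- Rationals are kept in lowest terms by a gcd that does not compute on a variable. Among
-- unnormalised fractions n/1 is literal, and the operations on it compute.
ℤ→ℚ-homo : ∀ n → toℚᵘ (ℤ→ℚ n) ℚᵘ.≃ ℚᵘ.mkℚᵘ n 0
ℤ→ℚ-homo n = ℚ.toℚᵘ-fromℚᵘ (ℚᵘ.mkℚᵘ n 0)

ℤ→ℚ-+ : ∀ m n → ℤ→ℚ (m ℤ.+ n) ≡ ℤ→ℚ m ℚ.+ ℤ→ℚ n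
ℤ→ℚ-+ m n = ℚ.toℚᵘ-injective (begin
  toℚᵘ (ℤ→ℚ (m ℤ.+ n))                   ≈⟨ ℤ→ℚ-homo (m ℤ.+ n) ⟩
  ℚᵘ.mkℚᵘ (m ℤ.+ n) 0                    ≡⟨ cong₂ (λ a b → ℚᵘ.mkℚᵘ (a ℤ.+ b) 0) (ℤ.*-identityʳ m) (ℤ.*-identityʳ n) ⟨
  ℚᵘ.mkℚᵘ m 0 ℚᵘ.+ ℚᵘ.mkℚᵘ n 0           ≈⟨ ℚᵘ.+-cong (ℤ→ℚ-homo m) (ℤ→ℚ-homo n) ⟨
  toℚᵘ (ℤ→ℚ m) ℚᵘ.+ toℚᵘ (ℤ→ℚ n)         ≈⟨ ℚ.toℚᵘ-homo-+ (ℤ→ℚ m) (ℤ→ℚ n) ⟨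
  toℚᵘ (ℤ→ℚ m ℚ.+ ℤ→ℚ n)                 ∎)
  where open ℚᵘ.≃-Reasoning

ℤ→ℚ-* : ∀ m n → ℤ→ℚ (m ℤ.* n) ≡ ℤ→ℚ m ℚ.* ℤ→ℚ n
ℤ→ℚ-* m n = ℚ.toℚᵘ-injective (begin
  toℚᵘ (ℤ→ℚ (m ℤ.* n))                   ≈⟨ ℤ→ℚ-homo (m ℤ.* n) ⟩
  ℚᵘ.mkℚᵘ m 0 ℚᵘ.* ℚᵘ.mkℚᵘ n 0           ≈⟨ ℚᵘ.*-cong (ℤ→ℚ-homo m) (ℤ→ℚ-homo n) ⟨
  toℚᵘ (ℤ→ℚ m) ℚᵘ.* toℚᵘ (ℤ→ℚ n)         ≈⟨ ℚ.toℚᵘ-homo-* (ℤ→ℚ m) (ℤ→ℚ n) ⟨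
  toℚᵘ (ℤ→ℚ m ℚ.* ℤ→ℚ n)                 ∎)
  where open ℚᵘ.≃-Reasoning

ℤ→ℚ-neg : ∀ n → ℤ→ℚ (ℤ.- n) ≡ ℚ.- ℤ→ℚ n
ℤ→ℚ-neg n = ℚ.toℚᵘ-injective (begin
  toℚᵘ (ℤ→ℚ (ℤ.- n))                     ≈⟨ ℤ→ℚ-homo (ℤ.- n) ⟩
  ℚᵘ.- ℚᵘ.mkℚᵘ n 0                       ≈⟨ ℚᵘ.-‿cong (ℤ→ℚ-homo n) ⟨
  ℚᵘ.- toℚᵘ (ℤ→ℚ n)                      ≈⟨ ℚ.toℚᵘ-homo‿- (ℤ→ℚ n) ⟨
  toℚᵘ (ℚ.- ℤ→ℚ n)                       ∎)
  where open ℚᵘ.≃-Reasoning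

ℤ→ℚ-injective : ∀ {m n} → ℤ→ℚ m ≡ ℤ→ℚ n → m ≡ n
ℤ→ℚ-injective {m} {n} eq with ℚᵘ.*≡* m≡n ←
  ℚᵘ.≃-trans (ℚᵘ.≃-sym (ℤ→ℚ-homo m)) (ℚᵘ.≃-trans (ℚᵘ.≃-reflexive (cong toℚᵘ eq)) (ℤ→ℚ-homo n)) =
  ℤ.*-cancelʳ-≡ m n (+ 1) m≡n

ℤ→ℚ-- : ∀ m n → ℤ→ℚ (m ℤ.- n) ≡ ℤ→ℚ m ℚ.- ℤ→ℚ n
ℤ→ℚ-- m n = trans (ℤ→ℚ-+ m (ℤ.- n)) (cong (ℤ→ℚ m ℚ.+_) (ℤ→ℚ-neg n))

-- Quaternion identities, conjugation matrices and elements of norm 2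

module Quaternions where

  open Quaternion
  open +-*-Solver using (Polynomial)

  quat-cong : ∀ {a b c d a′ b′ c′ d′} → a ≡ a′ → b ≡ b′ → c ≡ c′ → d ≡ d′ →
    quat a b c d ≡ quat a′ b′ c′ d′
  quat-cong refl refl refl refl = refl

  -- Quaternions of solver expressions: proveᴰ feeds the four components of a
  -- quaternion identity to the rational ring solver.
  record Dᵖ (n : ℕ) : Set where
    constructor quatᵖ
    field p₀ p₁ p₂ p₃ : Polynomial n
  open Dᵖ

  ⟦_⟧ᴰ : ∀ {n} → Dᵖ n → Vec ℚ n → D
  ⟦ quatᵖ a b c d ⟧ᴰ ρ = quat (⟦ a ⟧ ρ) (⟦ b ⟧ ρ) (⟦ c ⟧ ρ) (⟦ d ⟧ ρ)

  proveᴰ : ∀ {n} (ρ : Vec ℚ n) (l r : Dᵖ n) →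
    ⟦ p₀ l ⟧↓ ρ ≡ ⟦ p₀ r ⟧↓ ρ → ⟦ p₁ l ⟧↓ ρ ≡ ⟦ p₁ r ⟧↓ ρ →
    ⟦ p₂ l ⟧↓ ρ ≡ ⟦ p₂ r ⟧↓ ρ → ⟦ p₃ l ⟧↓ ρ ≡ ⟦ p₃ r ⟧↓ ρ →
    ⟦ l ⟧ᴰ ρ ≡ ⟦ r ⟧ᴰ ρ
  proveᴰ ρ (quatᵖ a b c d) (quatᵖ a′ b′ c′ d′) e₀ e₁ e₂ e₃ =
    quat-cong (prove ρ a a′ e₀) (prove ρ b b′ e₁) (prove ρ c c′ e₂) (prove ρ d d′ e₃)

  infixl 6 _+ᵖ_
  infixl 7 _*ᵖ_

  _+ᵖ_ _*ᵖ_ : ∀ {n} → Dᵖ n → Dᵖ n → Dᵖ n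
  quatᵖ a₀ a₁ a₂ a₃ +ᵖ quatᵖ b₀ b₁ b₂ b₃ = quatᵖ (a₀ :+ b₀) (a₁ :+ b₁) (a₂ :+ b₂) (a₃ :+ b₃)
  quatᵖ a₀ a₁ a₂ a₃ *ᵖ quatᵖ b₀ b₁ b₂ b₃ = quatᵖ
    (a₀ :* b₀ :- a₁ :* b₁ :- a₂ :* b₂ :- a₃ :* b₃)
    (a₀ :* b₁ :+ a₁ :* b₀ :+ a₂ :* b₃ :- a₃ :* b₂)
    (a₀ :* b₂ :- a₁ :* b₃ :+ a₂ :* b₀ :+ a₃ :* b₁)
    (a₀ :* b₃ :+ a₁ :* b₂ :- a₂ :* b₁ :+ a₃ :* b₀)

  conᵖ : ∀ {n} → D → Dᵖ n
  conᵖ (quat a b c d) = quatᵖ (con a) (con b) (con c) (con d)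

  scalarᵖ : ∀ {n} → Polynomial n → Dᵖ n
  scalarᵖ q = quatᵖ q (con 0ℚ) (con 0ℚ) (con 0ℚ)

  ιᵖ : ∀ {n} → Dᵖ n → Dᵖ n
  ιᵖ (quatᵖ a b c d) = quatᵖ a (:- b) (:- c) (:- d)

  fromRowᵖ : ∀ {n} → Polynomial n → Polynomial n → Polynomial n → Dᵖ n
  fromRowᵖ x y z = scalarᵖ x *ᵖ conᵖ (𝐛 0F) +ᵖ scalarᵖ y *ᵖ conᵖ (𝐛 1F) +ᵖ scalarᵖ z *ᵖ conᵖ (𝐛 2F)

  *-assoc : ∀ x y z → x * y * z ≡ x * (y * z)
  *-assoc (quat a₀ a₁ a₂ a₃) (quat b₀ b₁ b₂ b₃) (quat c₀ c₁ c₂ c₃) =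
    proveᴰ (a₀ ∷ a₁ ∷ a₂ ∷ a₃ ∷ b₀ ∷ b₁ ∷ b₂ ∷ b₃ ∷ c₀ ∷ c₁ ∷ c₂ ∷ c₃ ∷ [])
      (x *ᵖ y *ᵖ z) (x *ᵖ (y *ᵖ z)) refl refl refl refl
    where
    x = quatᵖ (var (# 0)) (var (# 1)) (var (# 2)) (var (# 3))
    y = quatᵖ (var (# 4)) (var (# 5)) (var (# 6)) (var (# 7))
    z = quatᵖ (var (# 8)) (var (# 9)) (var (# 10)) (var (# 11))

  *-identityˡ : ∀ x → 1# * x ≡ x
  *-identityˡ (quat a₀ a₁ a₂ a₃) =
    proveᴰ (a₀ ∷ a₁ ∷ a₂ ∷ a₃ ∷ []) (conᵖ 1# *ᵖ x) x refl refl refl refl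
    where x = quatᵖ (var (# 0)) (var (# 1)) (var (# 2)) (var (# 3))

  *-identityʳ : ∀ x → x * 1# ≡ x
  *-identityʳ (quat a₀ a₁ a₂ a₃) =
    proveᴰ (a₀ ∷ a₁ ∷ a₂ ∷ a₃ ∷ []) (x *ᵖ conᵖ 1#) x refl refl refl refl
    where x = quatᵖ (var (# 0)) (var (# 1)) (var (# 2)) (var (# 3))

  cancel-inner : ∀ x {y z} w → y * z ≡ 1# → x * y * (z * w) ≡ x * w
  cancel-inner x {y} {z} w yz≡1 = begin
    x * y * (z * w)    ≡⟨ *-assoc x y (z * w) ⟩
    x * (y * (z * w))  ≡⟨ cong (x *_) (*-assoc y z w) ⟨
    x * (y * z * w)    ≡⟨ cong (λ t → x * (t * w)) yz≡1 ⟩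
    x * (1# * w)       ≡⟨ cong (x *_) (*-identityˡ w) ⟩
    x * w              ∎
    where open ≡-Reasoning

  fromRow-cong : ∀ {x y : Row} → (∀ k → x k ≡ y k) → fromRow x ≡ fromRow y
  fromRow-cong x≡y = cong₂ _+_ (cong₂ _+_ (term 0F) (term 1F)) (term 2F)
    where
    term : ∀ k → _ ≡ _
    term k = cong (λ q → scalar q * 𝐛 k) (x≡y k)

  combine : Row → (Fin 3 → D) → D
  combine x v = scalar (x 0F) * v 0F + scalar (x 1F) * v 1F + scalar (x 2F) * v 2F

  fromRow-ᵣ· : ∀ x A → fromRow (x ᵣ· A) ≡ combine x (λ k → fromRow (A k))
  fromRow-ᵣ· x A = proveᴰ
    (x 0F ∷ x 1F ∷ x 2F ∷ A 0F 0F ∷ A 0F 1F ∷ A 0F 2F ∷ A 1F 0F ∷ A 1F 1F ∷ A 1F 2F ∷ A 2F 0F ∷ A 2F 1F ∷ A 2F 2F ∷ [])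
    (fromRowᵖ (entry a₀₀ a₁₀ a₂₀) (entry a₀₁ a₁₁ a₂₁) (entry a₀₂ a₁₂ a₂₂))
    (scalarᵖ x₀ *ᵖ fromRowᵖ a₀₀ a₀₁ a₀₂ +ᵖ scalarᵖ x₁ *ᵖ fromRowᵖ a₁₀ a₁₁ a₁₂ +ᵖ scalarᵖ x₂ *ᵖ fromRowᵖ a₂₀ a₂₁ a₂₂)
    refl refl refl refl
    where
    x₀ = var (# 0)
    x₁ = var (# 1)
    x₂ = var (# 2)
    a₀₀ = var (# 3)
    a₀₁ = var (# 4)
    a₀₂ = var (# 5)
    a₁₀ = var (# 6)
    a₁₁ = var (# 7)
    a₁₂ = var (# 8)
    a₂₀ = var (# 9)
    a₂₁ = var (# 10)
    a₂₂ = var (# 11)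
    -- The trailing zero mirrors the unfolding of `sum`.
    entry : Polynomial 12 → Polynomial 12 → Polynomial 12 → Polynomial 12
    entry a b c = x₀ :* a :+ (x₁ :* b :+ (x₂ :* c :+ con 0ℚ))

  conjugate-fromRow : ∀ h x g → h * fromRow x * g ≡ combine x (λ k → h * 𝐛 k * g)
  conjugate-fromRow (quat h₀ h₁ h₂ h₃) x (quat g₀ g₁ g₂ g₃) = proveᴰ
    (x 0F ∷ x 1F ∷ x 2F ∷ h₀ ∷ h₁ ∷ h₂ ∷ h₃ ∷ g₀ ∷ g₁ ∷ g₂ ∷ g₃ ∷ [])
    (h *ᵖ fromRowᵖ x₀ x₁ x₂ *ᵖ g)
    (scalarᵖ x₀ *ᵖ (h *ᵖ conᵖ (𝐛 0F) *ᵖ g) +ᵖ scalarᵖ x₁ *ᵖ (h *ᵖ conᵖ (𝐛 1F) *ᵖ g) +ᵖ scalarᵖ x₂ *ᵖ (h *ᵖ conᵖ (𝐛 2F) *ᵖ g))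
    refl refl refl refl
    where
    x₀ = var (# 0)
    x₁ = var (# 1)
    x₂ = var (# 2)
    h = quatᵖ (var (# 3)) (var (# 4)) (var (# 5)) (var (# 6))
    g = quatᵖ (var (# 7)) (var (# 8)) (var (# 9)) (var (# 10))

  -- Conjugation is linear, so three equations on the basis replace the quantifier over all rows.
  -- For concrete units they are closed and hold by computation.
  ≐𝓕-basis : ∀ A u → (∀ k → fromRow (A k) ≡ inv u * 𝐛 k * value u) → A ≐𝓕 u
  ≐𝓕-basis A u eq x = begin
    fromRow (x ᵣ· A)                                ≡⟨ fromRow-ᵣ· x A ⟩
    combine x (λ k → fromRow (A k))                 ≡⟨ cong₂ _+_ (cong₂ _+_ (term 0F) (term 1F)) (term 2F) ⟩
    combine x (λ k → inv u * 𝐛 k * value u)         ≡⟨ conjugate-fromRow (inv u) x (value u) ⟨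
    inv u * fromRow x * value u                     ∎
    where
    open ≡-Reasoning
    term : ∀ k → scalar (x k) * fromRow (A k) ≡ scalar (x k) * (inv u * 𝐛 k * value u)
    term k = cong (scalar (x k) *_) (eq k)

  ᵣ·-assoc : ∀ x A B k → (x ᵣ· A ᵣ· B) k ≡ (x ᵣ· (A · B)) k
  ᵣ·-assoc x A B k = solve 15 (λ x y z a₀₀ a₀₁ a₀₂ a₁₀ a₁₁ a₁₂ a₂₀ a₂₁ a₂₂ b₀ b₁ b₂ →
      (x :* a₀₀ :+ (y :* a₁₀ :+ (z :* a₂₀ :+ con 0ℚ))) :* b₀ :+
        ((x :* a₀₁ :+ (y :* a₁₁ :+ (z :* a₂₁ :+ con 0ℚ))) :* b₁ :+
          ((x :* a₀₂ :+ (y :* a₁₂ :+ (z :* a₂₂ :+ con 0ℚ))) :* b₂ :+ con 0ℚ))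
      := x :* (a₀₀ :* b₀ :+ (a₀₁ :* b₁ :+ (a₀₂ :* b₂ :+ con 0ℚ))) :+
        (y :* (a₁₀ :* b₀ :+ (a₁₁ :* b₁ :+ (a₁₂ :* b₂ :+ con 0ℚ))) :+
          (z :* (a₂₀ :* b₀ :+ (a₂₁ :* b₁ :+ (a₂₂ :* b₂ :+ con 0ℚ))) :+ con 0ℚ)))
    refl (x 0F) (x 1F) (x 2F)
    (A 0F 0F) (A 0F 1F) (A 0F 2F) (A 1F 0F) (A 1F 1F) (A 1F 2F) (A 2F 0F) (A 2F 1F) (A 2F 2F)
    (B 0F k) (B 1F k) (B 2F k)

  ᵣ·-identity : ∀ x {A} → A ≐ I₃ → ∀ k → (x ᵣ· A) k ≡ x k
  ᵣ·-identity x {A} A≐I k = trans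
    (cong₂ ℚ._+_ (term 0F) (cong₂ ℚ._+_ (term 1F) (cong₂ ℚ._+_ (term 2F) refl))) (unit k)
    where
    term : ∀ m → x m ℚ.* A m k ≡ x m ℚ.* I₃ m k
    term m = cong (x m ℚ.*_) (A≐I m k)

    unit : ∀ k → (x ᵣ· I₃) k ≡ x k
    unit 0F = solve 3 (λ x y z → x :* con 1ℚ :+ (y :* con 0ℚ :+ (z :* con 0ℚ :+ con 0ℚ)) := x) refl (x 0F) (x 1F) (x 2F)
    unit 1F = solve 3 (λ x y z → x :* con 0ℚ :+ (y :* con 1ℚ :+ (z :* con 0ℚ :+ con 0ℚ)) := y) refl (x 0F) (x 1F) (x 2F)
    unit 2F = solve 3 (λ x y z → x :* con 0ℚ :+ (y :* con 0ℚ :+ (z :* con 1ℚ :+ con 0ℚ)) := z) refl (x 0F) (x 1F) (x 2F)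

  -- Rational coefficients let the ring solver treat the coordinates as variables; 𝒪 consists of the
  -- values at integers.
  hurwitz : ℚ → ℚ → ℚ → ℚ → D
  hurwitz a b c d = scalar a + scalar b * i + scalar c * j + scalar d * w

  hurwitzᵖ : ∀ {n} → Polynomial n → Polynomial n → Polynomial n → Polynomial n → Dᵖ n
  hurwitzᵖ a b c d = scalarᵖ a +ᵖ scalarᵖ b *ᵖ conᵖ i +ᵖ scalarᵖ c *ᵖ conᵖ j +ᵖ scalarᵖ d *ᵖ conᵖ w

  hurwitz-cong : ∀ {a b c d a′ b′ c′ d′} → a ≡ a′ → b ≡ b′ → c ≡ c′ → d ≡ d′ →
    hurwitz a b c d ≡ hurwitz a′ b′ c′ d′
  hurwitz-cong refl refl refl refl = refl

  Nm-hurwitz : ∀ a b c d → D.a₀ (Nm (hurwitz a b c d)) ≡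
    a ℚ.* a ℚ.+ b ℚ.* b ℚ.+ c ℚ.* c ℚ.+ d ℚ.* d ℚ.+ d ℚ.* (a ℚ.+ b ℚ.+ c)
  Nm-hurwitz a b c d = prove (a ∷ b ∷ c ∷ d ∷ []) (p₀ (y *ᵖ ιᵖ y))
    (α :* α :+ β :* β :+ γ :* γ :+ η :* η :+ η :* (α :+ β :+ γ)) refl
    where
    α = var (# 0)
    β = var (# 1)
    γ = var (# 2)
    η = var (# 3)
    y = hurwitzᵖ α β γ η

  ℤ→ℚ-normForm : ∀ a b c d → D.a₀ (Nm (hurwitz (ℤ→ℚ a) (ℤ→ℚ b) (ℤ→ℚ c) (ℤ→ℚ d))) ≡ ℤ→ℚ (normForm a b c d)
  ℤ→ℚ-normForm a b c d = trans (Nm-hurwitz (ℤ→ℚ a) (ℤ→ℚ b) (ℤ→ℚ c) (ℤ→ℚ d)) (sym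
    (+-homo (a ℤ.* a ℤ.+ b ℤ.* b ℤ.+ c ℤ.* c ℤ.+ d ℤ.* d) (d ℤ.* (a ℤ.+ b ℤ.+ c))
      (+-homo (a ℤ.* a ℤ.+ b ℤ.* b ℤ.+ c ℤ.* c) (d ℤ.* d)
        (+-homo (a ℤ.* a ℤ.+ b ℤ.* b) (c ℤ.* c)
          (+-homo (a ℤ.* a) (b ℤ.* b) (ℤ→ℚ-* a a) (ℤ→ℚ-* b b)) (ℤ→ℚ-* c c)) (ℤ→ℚ-* d d))
      (trans (ℤ→ℚ-* d (a ℤ.+ b ℤ.+ c)) (cong (ℤ→ℚ d ℚ.*_) (+-homo (a ℤ.+ b) c (ℤ→ℚ-+ a b) refl)))))
    where
    +-homo : ∀ m n {x y} → ℤ→ℚ m ≡ x → ℤ→ℚ n ≡ y → ℤ→ℚ (m ℤ.+ n) ≡ x ℚ.+ y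
    +-homo m n p q = trans (ℤ→ℚ-+ m n) (cong₂ ℚ._+_ p q)

  1+i 1+i⁻¹ : D
  1+i   = 1# + i
  1+i⁻¹ = scalar ½ * ι 1+i

  -- The inverse carried by an element of `Dˣ` is abstract; only its explicit form can be tested for
  -- membership in 𝒪.
  norm-2-inverse : ∀ {y z} → Nm y ≡ scalar (ℤ→ℚ (+ 2)) → z * y ≡ 1# → z ≡ scalar ½ * ι y
  norm-2-inverse {y} {z} Nm≡2 zy≡1 = begin
    z                                         ≡⟨ halve z ⟩
    scalar ½ * (z * scalar (ℤ→ℚ (+ 2)))       ≡⟨ cong (λ t → scalar ½ * (z * t)) Nm≡2 ⟨
    scalar ½ * (z * (y * ι y))                ≡⟨ cong (scalar ½ *_) (*-assoc z y (ι y)) ⟨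
    scalar ½ * (z * y * ι y)                  ≡⟨ cong (λ t → scalar ½ * (t * ι y)) zy≡1 ⟩
    scalar ½ * (1# * ι y)                     ≡⟨ cong (scalar ½ *_) (*-identityˡ (ι y)) ⟩
    scalar ½ * ι y                            ∎
    where
    open ≡-Reasoning
    halve : ∀ z → z ≡ scalar ½ * (z * scalar (ℤ→ℚ (+ 2)))
    halve (quat a₀ a₁ a₂ a₃) = proveᴰ (a₀ ∷ a₁ ∷ a₂ ∷ a₃ ∷ []) x
      (conᵖ (scalar ½) *ᵖ (x *ᵖ conᵖ (scalar (ℤ→ℚ (+ 2))))) refl refl refl refl
      where x = quatᵖ (var (# 0)) (var (# 1)) (var (# 2)) (var (# 3))

  -- S and E are the halves of a + b + c and of d that the parity argument supplies. In these
  -- parameters division by 1 + i leaves integral coefficients; the next identity shows the same for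
  -- the inverse quotient.
  hurwitz*1+i⁻¹ : ∀ S B C E → hurwitz (S ℚ.+ S ℚ.- B ℚ.- C) B C (E ℚ.+ E) * 1+i⁻¹ ≡
      hurwitz (S ℚ.- C) (B ℚ.- S ℚ.- E) (ℚ.- E) (C ℚ.+ (E ℚ.+ E))
  hurwitz*1+i⁻¹ S B C E = proveᴰ (S ∷ B ∷ C ∷ E ∷ []) (yᵖ *ᵖ conᵖ 1+i⁻¹)
      (hurwitzᵖ (σ :- γ) (β :- σ :- η) (:- η) (γ :+ (η :+ η))) refl refl refl refl
    where
    σ β γ η : Polynomial 4
    σ = var (# 0)
    β = var (# 1)
    γ = var (# 2)
    η = var (# 3)
    yᵖ = hurwitzᵖ (σ :+ σ :- β :- γ) β γ (η :+ η)

  1+i*½ι-hurwitz : ∀ S B C E → 1+i * (scalar ½ * ι (hurwitz (S ℚ.+ S ℚ.- B ℚ.- C) B C (E ℚ.+ E))) ≡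
      hurwitz (S ℚ.+ (E ℚ.+ E)) (ℚ.- (B ℚ.- S ℚ.- E)) E (ℚ.- (C ℚ.+ (E ℚ.+ E)))
  1+i*½ι-hurwitz S B C E = proveᴰ (S ∷ B ∷ C ∷ E ∷ []) (conᵖ 1+i *ᵖ (conᵖ (scalar ½) *ᵖ ιᵖ yᵖ))
      (hurwitzᵖ (σ :+ (η :+ η)) (:- (β :- σ :- η)) η (:- (γ :+ (η :+ η)))) refl refl refl refl
    where
    σ β γ η : Polynomial 4
    σ = var (# 0)
    β = var (# 1)
    γ = var (# 2)
    η = var (# 3)
    yᵖ = hurwitzᵖ (σ :+ σ :- β :- γ) β γ (η :+ η)

  even⇒quotient∈𝒪 : ∀ {y} a b c d s e → y ≡ hurwitz (ℤ→ℚ a) (ℤ→ℚ b) (ℤ→ℚ c) (ℤ→ℚ d) →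
    a ℤ.+ b ℤ.+ c ≡ s ℤ.+ s → d ≡ e ℤ.+ e → 𝒪 (1+i * (scalar ½ * ι y)) × 𝒪 (y * 1+i⁻¹)
  even⇒quotient∈𝒪 {y} a b c d s e y≡ a+b+c≡2s d≡2e =
      ( s ℤ.+ (e ℤ.+ e) , ℤ.- (b ℤ.- s ℤ.- e) , e , ℤ.- (c ℤ.+ (e ℤ.+ e))
      , trans (cong (λ t → 1+i * (scalar ½ * ι t)) y≡′) (trans (1+i*½ι-hurwitz S B C E) (sym (hurwitz-cong
          (trans (ℤ→ℚ-+ s (e ℤ.+ e)) (cong (ℚ._+_ S) (ℤ→ℚ-+ e e)))
          (trans (ℤ→ℚ-neg (b ℤ.- s ℤ.- e)) (cong ℚ.-_ b-s-e))
          (refl {x = E})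
          (trans (ℤ→ℚ-neg (c ℤ.+ (e ℤ.+ e))) (cong ℚ.-_ c+2e))))) )
    , ( s ℤ.- c , b ℤ.- s ℤ.- e , ℤ.- e , c ℤ.+ (e ℤ.+ e)
      , trans (cong (_* 1+i⁻¹) y≡′) (trans (hurwitz*1+i⁻¹ S B C E) (sym (hurwitz-cong
          (ℤ→ℚ-- s c) b-s-e (ℤ→ℚ-neg e) c+2e))) )
    where
    S = ℤ→ℚ s
    B = ℤ→ℚ b
    C = ℤ→ℚ c
    E = ℤ→ℚ e

    a≡ : a ≡ s ℤ.+ s ℤ.- b ℤ.- c
    a≡ = trans (identity a b c) (cong (λ t → t ℤ.- b ℤ.- c) a+b+c≡2s)
      where
      identity : ∀ a b c → a ≡ a ℤ.+ b ℤ.+ c ℤ.- b ℤ.- c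
      identity = ℤ.solve-∀

    y≡′ : y ≡ hurwitz (S ℚ.+ S ℚ.- B ℚ.- C) B C (E ℚ.+ E)
    y≡′ = trans y≡ (hurwitz-cong
      (trans (cong ℤ→ℚ a≡) (trans (ℤ→ℚ-- (s ℤ.+ s ℤ.- b) c)
        (cong (ℚ._- C) (trans (ℤ→ℚ-- (s ℤ.+ s) b) (cong (ℚ._- B) (ℤ→ℚ-+ s s))))))
      (refl {x = B}) (refl {x = C}) (trans (cong ℤ→ℚ d≡2e) (ℤ→ℚ-+ e e)))

    b-s-e : ℤ→ℚ (b ℤ.- s ℤ.- e) ≡ B ℚ.- S ℚ.- E
    b-s-e = trans (ℤ→ℚ-- (b ℤ.- s) e) (cong (ℚ._- E) (ℤ→ℚ-- b s))

    c+2e : ℤ→ℚ (c ℤ.+ (e ℤ.+ e)) ≡ C ℚ.+ (E ℚ.+ E)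
    c+2e = trans (ℤ→ℚ-+ c (e ℤ.+ e)) (cong (ℚ._+_ C) (ℤ→ℚ-+ e e))

  -- The elements of 𝒪 of norm 2 form the single coset 𝒪ˣ(1 + i).
  norm-2-quotient : ∀ y → 𝒪 y → Nm y ≡ scalar (ℤ→ℚ (+ 2)) →
    𝒪 (1+i * (scalar ½ * ι y)) × 𝒪 (y * 1+i⁻¹)
  norm-2-quotient y (a , b , c , d , y≡) Nm≡2 =
    let s , e , a+b+c≡2s , d≡2e = normForm≡2⇒even a b c d norm≡2
    in even⇒quotient∈𝒪 a b c d s e y≡ a+b+c≡2s d≡2e
    where
    norm≡2 : normForm a b c d ≡ + 2
    norm≡2 = ℤ→ℚ-injective (trans (sym (ℤ→ℚ-normForm a b c d)) (cong D.a₀ (trans (cong Nm (sym y≡)) Nm≡2)))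

  -- Inverse to `fromRow` on V_D: the coefficients p, q, r of i, j, ij are -x₁+x₂+x₃, x₁-x₂+x₃,
  -- x₁+x₂-x₃, so each coordinate is half the sum of two of them.
  coordinates : D → Row
  coordinates (quat _ p q r) 0F = ½ ℚ.* (q ℚ.+ r)
  coordinates (quat _ p q r) 1F = ½ ℚ.* (p ℚ.+ r)
  coordinates (quat _ p q r) 2F = ½ ℚ.* (p ℚ.+ q)

  -- This is 𝓕(g) when h is the inverse of g.
  conjugation : D → D → Matrix
  conjugation g h k = coordinates (h * 𝐛 k * g)

  ι-hurwitz : ∀ a b c d → ι (hurwitz a b c d) ≡ hurwitz (a ℚ.+ d) (ℚ.- b) (ℚ.- c) (ℚ.- d)
  ι-hurwitz a b c d = proveᴰ (a ∷ b ∷ c ∷ d ∷ []) (ιᵖ (hurwitzᵖ α β γ η))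
    (hurwitzᵖ (α :+ η) (:- β) (:- γ) (:- η)) refl refl refl refl
    where
    α = var (# 0)
    β = var (# 1)
    γ = var (# 2)
    η = var (# 3)

  𝒪-ι : ∀ {x} → 𝒪 x → 𝒪 (ι x)
  𝒪-ι {x} (a , b , c , d , x≡) = a ℤ.+ d , ℤ.- b , ℤ.- c , ℤ.- d ,
    trans (cong ι x≡) (trans (ι-hurwitz (ℤ→ℚ a) (ℤ→ℚ b) (ℤ→ℚ c) (ℤ→ℚ d))
      (sym (hurwitz-cong (ℤ→ℚ-+ a d) (ℤ→ℚ-neg b) (ℤ→ℚ-neg c) (ℤ→ℚ-neg d))))

  sandwich : ∀ a b x c d → a * b * x * (c * d) ≡ a * (b * x * c) * d
  sandwich a b x c d = trans (sym (*-assoc (a * b * x) c d))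
    (cong (_* d) (trans (cong (_* c) (*-assoc a b x)) (*-assoc a (b * x) c)))

  unsandwich : ∀ {y z} x → y * z ≡ 1# → y * (z * x * y) * z ≡ x
  unsandwich {y} {z} x yz≡1 = begin
    y * (z * x * y) * z    ≡⟨ sandwich y z x y z ⟨
    y * z * x * (y * z)    ≡⟨ cong₂ (λ s t → s * x * t) yz≡1 yz≡1 ⟩
    1# * x * 1#            ≡⟨ *-identityʳ (1# * x) ⟩
    1# * x                 ≡⟨ *-identityˡ x ⟩
    x                      ∎
    where open ≡-Reasoning

  1+iˣ : Dˣ
  1+iˣ = 1+i , 1+i⁻¹ , refl , refl

  A₀ : Matrix
  A₀ = conjugation 1+i 1+i⁻¹

  A₀≐𝓕1+i : A₀ ≐𝓕 1+iˣ
  A₀≐𝓕1+i = ≐𝓕-basis A₀ 1+iˣ basis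
    where
    basis : ∀ k → fromRow (A₀ k) ≡ 1+i⁻¹ * 𝐛 k * 1+i
    basis 0F = refl
    basis 1F = refl
    basis 2F = refl

  -- Since x𝓕(g)𝓕(h) = h⁻¹g⁻¹xgh, 𝓕 preserves the order of products, and for ρ = 𝓕(y) the matrix is
  -- 𝓕((1 + i)y⁻¹). Both (1 + i)y⁻¹ and its inverse y(1 + i)⁻¹ lie in 𝒪, as `𝒪ˣ` demands.
  A₀·ρ⁻¹∈Γ : ∀ ρ → 𝔗₂ (matrix ρ) → Γ (A₀ · inverse ρ)
  A₀·ρ⁻¹∈Γ (R , B , BR≐I , _) ((y , z , zy≡1 , yz≡1) , y∈𝒪 , Nm≡2 , R≐𝓕y) =
    (1+i * z , y * 1+i⁻¹ , trans (cancel-inner y {1+i⁻¹} {1+i} z refl) yz≡1 , cancel-inner 1+i {z} {y} 1+i⁻¹ zy≡1) ,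
    (subst (λ t → 𝒪 (1+i * t)) (sym (norm-2-inverse {y} {z} Nm≡2 zy≡1)) (proj₁ quotients) , proj₂ quotients) ,
    conjugates
    where
    open ≡-Reasoning
    quotients = norm-2-quotient y y∈𝒪 Nm≡2

    conjugates : ∀ x → fromRow (x ᵣ· (A₀ · B)) ≡ y * 1+i⁻¹ * fromRow x * (1+i * z)
    conjugates x = begin
      fromRow (x ᵣ· (A₀ · B))                             ≡⟨ fromRow-cong (ᵣ·-assoc x A₀ B) ⟨
      -- `B` is known only as a matrix inverse, with no quaternion attached. Conjugating by y and
      -- back brings `R` in next to `B`, and the two cancel.
      fromRow (x ᵣ· A₀ ᵣ· B)                              ≡⟨ unsandwich {y} {z} (fromRow (x ᵣ· A₀ ᵣ· B)) yz≡1 ⟨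
      y * (z * fromRow (x ᵣ· A₀ ᵣ· B) * y) * z            ≡⟨ cong (λ t → y * t * z) (R≐𝓕y (x ᵣ· A₀ ᵣ· B)) ⟨
      y * fromRow (x ᵣ· A₀ ᵣ· B ᵣ· R) * z
        ≡⟨ cong (λ t → y * t * z) (fromRow-cong (λ k → trans (ᵣ·-assoc (x ᵣ· A₀) B R k) (ᵣ·-identity (x ᵣ· A₀) BR≐I k))) ⟩
      y * fromRow (x ᵣ· A₀) * z                           ≡⟨ cong (λ t → y * t * z) (A₀≐𝓕1+i x) ⟩
      y * (1+i⁻¹ * fromRow x * 1+i) * z                   ≡⟨ sandwich y 1+i⁻¹ (fromRow x) 1+i z ⟨
      y * 1+i⁻¹ * fromRow x * (1+i * z)                   ∎

  hurwitzMatrix : ℤ → ℤ → ℤ → ℤ → Matrix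
  hurwitzMatrix a b c d = conjugation u (ι u)
    where u = hurwitz (ℤ→ℚ a) (ℤ→ℚ b) (ℤ→ℚ c) (ℤ→ℚ d)

  -- The conjugate serves as the inverse because the units have norm 1. For given coefficients every
  -- hypothesis is a closed identity.
  hurwitzMatrix∈Γ : ∀ a b c d →
    let A = hurwitzMatrix a b c d
        u = hurwitz (ℤ→ℚ a) (ℤ→ℚ b) (ℤ→ℚ c) (ℤ→ℚ d) in
    ι u * u ≡ 1# → u * ι u ≡ 1# →
    fromRow (A 0F) ≡ ι u * 𝐛 0F * u → fromRow (A 1F) ≡ ι u * 𝐛 1F * u → fromRow (A 2F) ≡ ι u * 𝐛 2F * u →
    Γ A
  hurwitzMatrix∈Γ a b c d ιu*u≡1 u*ιu≡1 row₀ row₁ row₂ =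
    uˣ , (u∈𝒪 , 𝒪-ι u∈𝒪) , ≐𝓕-basis (hurwitzMatrix a b c d) uˣ λ where
      0F → row₀
      1F → row₁
      2F → row₂
    where
    u = hurwitz (ℤ→ℚ a) (ℤ→ℚ b) (ℤ→ℚ c) (ℤ→ℚ d)

    uˣ : Dˣ
    uˣ = u , ι u , ιu*u≡1 , u*ιu≡1

    u∈𝒪 : 𝒪 u
    u∈𝒪 = a , b , c , d , refl

open Quaternions using (A₀; A₀·ρ⁻¹∈Γ; hurwitzMatrix; hurwitzMatrix∈Γ)
open Polynomial

-- Polynomials up to _≈_

-- Polynomials are compared through all linear functionals at once: the value of
-- a functional on a product or a substitution is a functional of the factors.
lin : (Exponent → ℚ) → Poly → ℚ
lin F []            = 0ℚ
lin F ((c , d) ∷ f) = c ℚ.* F d ℚ.+ lin F f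

infixl 6 _⊕_
_⊕_ : Exponent → Exponent → Exponent
_⊕_ = Vec.zipWith ℕ._+_

δ : Exponent → Exponent → ℚ
δ e d = if does (d ≟ᴱ e) then 1ℚ else 0ℚ

coeff-lin : ∀ f e → coeff f e ≡ lin (δ e) f
coeff-lin []            e = refl
coeff-lin ((c , d) ∷ f) e with d ≟ᴱ e
... | yes _ = cong₂ ℚ._+_ (sym (ℚ.*-identityʳ c)) (coeff-lin f e)
... | no _  = trans (coeff-lin f e)
  (trans (sym (ℚ.+-identityˡ _)) (cong (ℚ._+ lin (δ e) f) (sym (ℚ.*-zeroʳ c))))

lin-cong : ∀ {F G} → (∀ d → F d ≡ G d) → ∀ f → lin F f ≡ lin G f
lin-cong F≡G []            = refl
lin-cong F≡G ((c , d) ∷ f) = cong₂ ℚ._+_ (cong (c ℚ.*_) (F≡G d)) (lin-cong F≡G f)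

lin-+ : ∀ F f g → lin F (f + g) ≡ lin F f ℚ.+ lin F g
lin-+ F []            g = sym (ℚ.+-identityˡ _)
lin-+ F ((c , d) ∷ f) g =
  trans (cong (c ℚ.* F d ℚ.+_) (lin-+ F f g)) (sym (ℚ.+-assoc (c ℚ.* F d) (lin F f) (lin F g)))

lin-neg : ∀ F f → lin F (- f) ≡ ℚ.- lin F f
lin-neg F []            = refl
lin-neg F ((c , d) ∷ f) rewrite lin-neg F f =
  solve 3 (λ c x y → (:- c) :* x :+ (:- y) := :- (c :* x :+ y)) refl c (F d) (lin F f)

lin-zero : ∀ f → lin (λ _ → 0ℚ) f ≡ 0ℚ
lin-zero []            = refl
lin-zero ((c , d) ∷ f) rewrite lin-zero f | ℚ.*-zeroʳ c = refl

lin-⟨+⟩ : ∀ F G f → lin (λ d → F d ℚ.+ G d) f ≡ lin F f ℚ.+ lin G f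
lin-⟨+⟩ F G []            = refl
lin-⟨+⟩ F G ((c , d) ∷ f) rewrite lin-⟨+⟩ F G f =
  solve 5 (λ c x y u v → c :* (x :+ y) :+ (u :+ v) := (c :* x :+ u) :+ (c :* y :+ v))
    refl c (F d) (G d) (lin F f) (lin G f)

lin-⟨*⟩ : ∀ a F f → lin (λ d → a ℚ.* F d) f ≡ a ℚ.* lin F f
lin-⟨*⟩ a F []            = sym (ℚ.*-zeroʳ a)
lin-⟨*⟩ a F ((c , d) ∷ f) rewrite lin-⟨*⟩ a F f =
  solve 4 (λ a c x u → c :* (a :* x) :+ a :* u := a :* (c :* x :+ u)) refl a c (F d) (lin F f)

-- Interchange of two finite sums. Commutativity of `_*_` rests on it, the two orders of a product
-- being different lists.
lin-swap : ∀ (H : Exponent → Exponent → ℚ) f g →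
  lin (λ d → lin (H d) g) f ≡ lin (λ e → lin (λ d → H d e) f) g
lin-swap H []            g = sym (lin-zero g)
lin-swap H ((c , d) ∷ f) g = begin
  c ℚ.* lin (H d) g ℚ.+ lin (λ d → lin (H d) g) f
    ≡⟨ cong₂ ℚ._+_ (sym (lin-⟨*⟩ c (H d) g)) (lin-swap H f g) ⟩
  lin (λ e → c ℚ.* H d e) g ℚ.+ lin (λ e → lin (λ d → H d e) f) g
    ≡⟨ lin-⟨+⟩ (λ e → c ℚ.* H d e) (λ e → lin (λ d → H d e) f) g ⟨
  lin (λ e → c ℚ.* H d e ℚ.+ lin (λ d → H d e) f) g ∎
  where open ≡-Reasoning

lin-monomial* : ∀ F c d g →
  lin F (List.map (λ (c′ , d′) → c ℚ.* c′ , d ⊕ d′) g) ≡ c ℚ.* lin (λ e → F (d ⊕ e)) g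
lin-monomial* F c d []            = sym (ℚ.*-zeroʳ c)
lin-monomial* F c d ((b , e) ∷ g) rewrite lin-monomial* F c d g =
  solve 4 (λ c b x u → c :* b :* x :+ c :* u := c :* (b :* x :+ u)) refl
    c b (F (d ⊕ e)) (lin (λ e → F (d ⊕ e)) g)

lin-* : ∀ F f g → lin F (f * g) ≡ lin (λ d → lin (λ e → F (d ⊕ e)) g) f
lin-* F []            g = refl
lin-* F ((c , d) ∷ f) g =
  trans (lin-+ F (List.map (λ (c′ , d′) → c ℚ.* c′ , d ⊕ d′) g) (f * g))
        (cong₂ ℚ._+_ (lin-monomial* F c d g) (lin-* F f g))

remove : Exponent → Poly → Poly
remove e []            = []
remove e ((c , d) ∷ f) with d ≟ᴱ e
... | yes _ = remove e f
... | no _  = (c , d) ∷ remove e f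

length-remove : ∀ e f → List.length (remove e f) ≤ List.length f
length-remove e []            = z≤n
length-remove e ((c , d) ∷ f) with d ≟ᴱ e
... | yes _ = ℕ.m≤n⇒m≤1+n (length-remove e f)
... | no _  = s≤s (length-remove e f)

lin-remove : ∀ F e f → lin F f ≡ coeff f e ℚ.* F e ℚ.+ lin F (remove e f)
lin-remove F e []            = sym (trans (ℚ.+-identityʳ _) (ℚ.*-zeroˡ (F e)))
lin-remove F e ((c , d) ∷ f) rewrite lin-remove F e f with d ≟ᴱ e
... | yes refl = solve 4 (λ c x a u → c :* x :+ (a :* x :+ u) := (c :+ a) :* x :+ u) refl
                   c (F e) (coeff f e) (lin F (remove e f))
... | no _     = solve 5 (λ c y x a u → c :* y :+ (a :* x :+ u) := a :* x :+ (c :* y :+ u)) refl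
                   c (F d) (F e) (coeff f e) (lin F (remove e f))

coeff-remove-≡ : ∀ e f → coeff (remove e f) e ≡ 0ℚ
coeff-remove-≡ e []            = refl
coeff-remove-≡ e ((c , d) ∷ f) with d ≟ᴱ e in eq
... | yes _                = coeff-remove-≡ e f
... | no _  rewrite eq     = coeff-remove-≡ e f

coeff-remove-≢ : ∀ {e e′} f → e ≢ e′ → coeff (remove e f) e′ ≡ coeff f e′
coeff-remove-≢ {e} {e′} []            e≢e′ = refl
coeff-remove-≢ {e} {e′} ((c , d) ∷ f) e≢e′ with d ≟ᴱ e
coeff-remove-≢ {e} {e′} ((c , d) ∷ f) e≢e′ | yes refl with d ≟ᴱ e′
... | yes d≡e′ = contradiction d≡e′ e≢e′
... | no _     = coeff-remove-≢ f e≢e′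
coeff-remove-≢ {e} {e′} ((c , d) ∷ f) e≢e′ | no _ with d ≟ᴱ e′
... | yes _ = cong (c ℚ.+_) (coeff-remove-≢ f e≢e′)
... | no _  = coeff-remove-≢ f e≢e′

coeff-remove-0 : ∀ d f {e} → coeff f e ≡ 0ℚ → coeff (remove d f) e ≡ 0ℚ
coeff-remove-0 d f {e} f≡0 with d ≟ᴱ e
... | yes refl = coeff-remove-≡ d f
... | no d≢e   = trans (coeff-remove-≢ f d≢e) f≡0

-- Terms may cancel, so an exponent in the list need not be in the support; each
-- step strips all terms with the exponent of the first one.
lin-support : ∀ {F G} f → (∀ e → coeff f e ≢ 0ℚ → F e ≡ G e) → lin F f ≡ lin G f
lin-support f = go (List.length f) f ℕ.≤-refl
  where
  -- The bound `n` on the length drives the recursion, because `remove d f` is not a structural part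
  -- of `f`.
  go : ∀ {F G} n f → List.length f ≤ n → (∀ e → coeff f e ≢ 0ℚ → F e ≡ G e) → lin F f ≡ lin G f
  go n       []              _         F≡G = refl
  go {F} {G} (suc n) f@((c , d) ∷ f′) (s≤s ∣f′∣≤n) F≡G = begin
    lin F f                                        ≡⟨ lin-remove F d f ⟩
    coeff f d ℚ.* F d ℚ.+ lin F (remove d f)       ≡⟨ cong₂ ℚ._+_ head tail ⟩
    coeff f d ℚ.* G d ℚ.+ lin G (remove d f)       ≡⟨ lin-remove G d f ⟨
    lin G f                                        ∎
    where
    open ≡-Reasoning

    head : coeff f d ℚ.* F d ≡ coeff f d ℚ.* G d
    head with coeff f d ℚ.≟ 0ℚ
    ... | yes p = trans (cong (ℚ._* F d) p) (trans (ℚ.*-zeroˡ (F d))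
                    (sym (trans (cong (ℚ._* G d) p) (ℚ.*-zeroˡ (G d)))))
    ... | no p  = cong (coeff f d ℚ.*_) (F≡G d p)

    removed≤n : List.length (remove d f) ≤ n
    removed≤n with d ≟ᴱ d
    ... | yes _  = ℕ.≤-trans (length-remove d f′) ∣f′∣≤n
    ... | no d≢d = contradiction refl d≢d

    tail : lin F (remove d f) ≡ lin G (remove d f)
    tail = go n (remove d f) removed≤n λ e ≢0 → F≡G e λ f≡0 → ≢0 (coeff-remove-0 d f f≡0)

infix 4 _≋_
-- A record, so that both polynomials can be inferred from the type of a proof: `lin` is not
-- injective for unification.
record _≋_ (f g : Poly) : Set where
  constructor mk≋
  field lin-≡ : ∀ F → lin F f ≡ lin F g
open _≋_ public

≋⇒≈ : ∀ {f g} → f ≋ g → f ≈ g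
≋⇒≈ {f} {g} f≋g e = trans (coeff-lin f e) (trans (lin-≡ f≋g (δ e)) (sym (coeff-lin g e)))

x-y≡0⇒x≡y : ∀ {x y} → x ℚ.- y ≡ 0ℚ → x ≡ y
x-y≡0⇒x≡y {x} {y} eq = trans (solve 2 (λ x y → x := (x :+ :- y) :+ y) refl x y)
  (trans (cong (ℚ._+ y) eq) (ℚ.+-identityˡ y))

lin-- : ∀ F f g → lin F (f - g) ≡ lin F f ℚ.- lin F g
lin-- F f g = trans (lin-+ F f (- g)) (cong (lin F f ℚ.+_) (lin-neg F g))

≈0⇒≋0 : ∀ f → (∀ e → coeff f e ≡ 0ℚ) → f ≋ []
≈0⇒≋0 f f≈0 .lin-≡ F = trans (lin-support f λ e ≢0 → contradiction (f≈0 e) ≢0) (lin-zero f)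

-≋0⇒≋ : ∀ {f g} → f - g ≋ [] → f ≋ g
-≋0⇒≋ {f} {g} eq .lin-≡ F = x-y≡0⇒x≡y (trans (sym (lin-- F f g)) (lin-≡ eq F))

-- `lin-support` compares two functionals on one polynomial, so the claim is moved to the
-- difference. Its support is empty, and every functional agrees there with the zero functional.
≈⇒≋ : ∀ {f g} → f ≈ g → f ≋ g
≈⇒≋ {f} {g} f≈g = -≋0⇒≋ (≈0⇒≋0 (f - g) λ e → begin
  coeff (f - g) e                    ≡⟨ coeff-lin (f - g) e ⟩
  lin (δ e) (f - g)                  ≡⟨ lin-- (δ e) f g ⟩
  lin (δ e) f ℚ.- lin (δ e) g        ≡⟨ cong₂ ℚ._-_ (coeff-lin f e) (coeff-lin g e) ⟨
  coeff f e ℚ.- coeff g e            ≡⟨ cong (ℚ._- coeff g e) (f≈g e) ⟩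
  coeff g e ℚ.- coeff g e            ≡⟨ ℚ.+-inverseʳ (coeff g e) ⟩
  0ℚ                                 ∎)
  where open ≡-Reasoning

⊕-assoc : ∀ d e f → (d ⊕ e) ⊕ f ≡ d ⊕ (e ⊕ f)
⊕-assoc = Vec.zipWith-assoc ℕ.+-assoc

⊕-comm : ∀ d e → d ⊕ e ≡ e ⊕ d
⊕-comm = Vec.zipWith-comm ℕ.+-comm

⊕-identityˡ : ∀ e → Vec.replicate 3 0 ⊕ e ≡ e
⊕-identityˡ = Vec.zipWith-identityˡ ℕ.+-identityˡ

lin-C* : ∀ F c f → lin F (C c * f) ≡ c ℚ.* lin F f
lin-C* F c f = trans (lin-* F (C c) f) (trans (ℚ.+-identityʳ _)
  (cong (c ℚ.*_) (lin-cong (λ e → cong F (⊕-identityˡ e)) f)))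

polyRing : CommutativeRing 0ℓ 0ℓ
polyRing = record
  { Carrier = Poly ; _≈_ = _≋_ ; _+_ = _+_ ; _*_ = _*_ ; -_ = -_ ; 0# = [] ; 1# = C 1ℚ
  ; isCommutativeRing = record
    { isRing = record
      { +-isAbelianGroup = record
        { isGroup = record
          { isMonoid = record
            { isSemigroup = record
              { isMagma = record
                { isEquivalence = record
                  { refl  = mk≋ λ F → refl
                  ; sym   = λ p → mk≋ λ F → sym (lin-≡ p F)
                  ; trans = λ p q → mk≋ λ F → trans (lin-≡ p F) (lin-≡ q F)
                  }
                ; ∙-cong = λ {f} {f′} {g} {g′} p q → mk≋ λ F →
                    trans (lin-+ F f g) (trans (cong₂ ℚ._+_ (lin-≡ p F) (lin-≡ q F)) (sym (lin-+ F f′ g′)))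
                }
              ; assoc = λ f g h → mk≋ λ F → cong (lin F) (List.++-assoc f g h)
              }
            ; identity = (λ f → mk≋ λ F → refl) , (λ f → mk≋ λ F → cong (lin F) (List.++-identityʳ f))
            }
          ; inverse = (λ f → mk≋ λ F → trans (lin-+ F (- f) f)
                        (trans (cong (ℚ._+ lin F f) (lin-neg F f)) (ℚ.+-inverseˡ (lin F f))))
                    , (λ f → mk≋ λ F → trans (lin-- F f f) (ℚ.+-inverseʳ (lin F f)))
          ; ⁻¹-cong = λ {f} {g} p → mk≋ λ F →
              trans (lin-neg F f) (trans (cong ℚ.-_ (lin-≡ p F)) (sym (lin-neg F g)))
          }
        ; comm = +-comm
        }
      ; *-cong = λ {f} {f′} {g} {g′} p q → mk≋ λ F → begin
          lin F (f * g)                                ≡⟨ lin-* F f g ⟩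
          lin (λ d → lin (λ e → F (d ⊕ e)) g) f        ≡⟨ lin-≡ p _ ⟩
          lin (λ d → lin (λ e → F (d ⊕ e)) g) f′       ≡⟨ lin-cong (λ d → lin-≡ q _) f′ ⟩
          lin (λ d → lin (λ e → F (d ⊕ e)) g′) f′      ≡⟨ lin-* F f′ g′ ⟨
          lin F (f′ * g′)                              ∎
      ; *-assoc = λ f g h → mk≋ λ F → begin
          lin F (f * g * h)
            ≡⟨ lin-* F (f * g) h ⟩
          lin (λ x → lin (λ z → F (x ⊕ z)) h) (f * g)
            ≡⟨ lin-* _ f g ⟩
          lin (λ x → lin (λ y → lin (λ z → F ((x ⊕ y) ⊕ z)) h) g) f
            ≡⟨ lin-cong (λ x → lin-cong (λ y → lin-cong (λ z → cong F (⊕-assoc x y z)) h) g) f ⟩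
          lin (λ x → lin (λ y → lin (λ z → F (x ⊕ (y ⊕ z))) h) g) f
            ≡⟨ lin-cong (λ x → lin-* (λ z → F (x ⊕ z)) g h) f ⟨
          lin (λ x → lin (λ z → F (x ⊕ z)) (g * h)) f
            ≡⟨ lin-* F f (g * h) ⟨
          lin F (f * (g * h)) ∎
      ; *-identity = *-identityˡ , λ f → mk≋ λ F → trans (lin-≡ (*-comm f (C 1ℚ)) F) (lin-≡ (*-identityˡ f) F)
      ; distrib = (λ f g h → mk≋ λ F →
                    trans (lin-≡ (*-comm f (g + h)) F)
                    (trans (lin-≡ (distribʳ f g h) F)
                    (trans (lin-+ F (g * f) (h * f))
                    (trans (cong₂ ℚ._+_ (lin-≡ (*-comm g f) F) (lin-≡ (*-comm h f) F))
                    (sym (lin-+ F (f * g) (f * h)))))))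
                , distribʳ
      }
    ; *-comm = *-comm
    }
  }
  where
  open ≡-Reasoning

  +-comm : ∀ f g → f + g ≋ g + f
  +-comm f g .lin-≡ F = trans (lin-+ F f g) (trans (ℚ.+-comm (lin F f) (lin F g)) (sym (lin-+ F g f)))

  *-comm : ∀ f g → f * g ≋ g * f
  *-comm f g .lin-≡ F = begin
    lin F (f * g)                            ≡⟨ lin-* F f g ⟩
    lin (λ d → lin (λ e → F (d ⊕ e)) g) f    ≡⟨ lin-swap (λ d e → F (d ⊕ e)) f g ⟩
    lin (λ e → lin (λ d → F (d ⊕ e)) f) g    ≡⟨ lin-cong (λ e → lin-cong (λ d → cong F (⊕-comm d e)) f) g ⟩
    lin (λ e → lin (λ d → F (e ⊕ d)) f) g    ≡⟨ lin-* F g f ⟨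
    lin F (g * f)                            ∎

  *-identityˡ : ∀ f → C 1ℚ * f ≋ f
  *-identityˡ f .lin-≡ F = trans (lin-C* F 1ℚ f) (ℚ.*-identityˡ (lin F f))

  distribʳ : ∀ f g h → (g + h) * f ≋ g * f + h * f
  distribʳ f g h .lin-≡ F = begin
    lin F ((g + h) * f)                     ≡⟨ lin-* F (g + h) f ⟩
    lin (λ d → lin (λ e → F (d ⊕ e)) f) (g + h)                      ≡⟨ lin-+ _ g h ⟩
    lin (λ d → lin (λ e → F (d ⊕ e)) f) g ℚ.+ lin (λ d → lin (λ e → F (d ⊕ e)) f) h
      ≡⟨ cong₂ ℚ._+_ (lin-* F g f) (lin-* F h f) ⟨
    lin F (g * f) ℚ.+ lin F (h * f)         ≡⟨ lin-+ F (g * f) (h * f) ⟨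
    lin F (g * f + h * f)                   ∎

module ≋ = CommutativeRing polyRing
module ≋-Reasoning = SetoidReasoning ≋.setoid

poly : AlmostCommutativeRing 0ℓ 0ℓ
poly = fromCommutativeRing polyRing (λ _ → nothing)

-- Powers, monomials and substitution

interchange : ∀ a b c d → (a * b) * (c * d) ≋ (a * c) * (b * d)
interchange = solve-∀ poly

^-cong : ∀ {f g} n → f ≋ g → f ^ n ≋ g ^ n
^-cong zero    f≋g = ≋.refl
^-cong (suc n) f≋g = ≋.*-cong f≋g (^-cong n f≋g)

^-+ : ∀ f m n → f ^ (m ℕ.+ n) ≋ f ^ m * f ^ n
^-+ f zero    n = ≋.sym (≋.*-identityˡ (f ^ n))
^-+ f (suc m) n = ≋.trans (≋.*-cong (≋.refl {f}) (^-+ f m n)) (≋.sym (≋.*-assoc f (f ^ m) (f ^ n)))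

*-^ : ∀ f g n → (f * g) ^ n ≋ f ^ n * g ^ n
*-^ f g zero    = ≋.sym (≋.*-identityˡ (C 1ℚ))
*-^ f g (suc n) = ≋.trans (≋.*-cong (≋.refl {f * g}) (*-^ f g n)) (interchange f g (f ^ n) (g ^ n))

monomial : (Fin 3 → Poly) → Exponent → Poly
monomial p d = product (λ k → p k ^ Vec.lookup d k)

monomial-cong : ∀ {p q} → (∀ k → p k ≋ q k) → ∀ d → monomial p d ≋ monomial q d
monomial-cong p≋q (a ∷ b ∷ c ∷ []) =
  ≋.*-cong (^-cong a (p≋q 0F)) (≋.*-cong (^-cong b (p≋q 1F)) (≋.*-cong (^-cong c (p≋q 2F)) ≋.refl))

monomial-⊕ : ∀ p d e → monomial p (d ⊕ e) ≋ monomial p d * monomial p e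
monomial-⊕ p (a ∷ b ∷ c ∷ []) (a′ ∷ b′ ∷ c′ ∷ []) = begin
  monomial p ((a ∷ b ∷ c ∷ []) ⊕ (a′ ∷ b′ ∷ c′ ∷ []))
    ≈⟨ ≋.*-cong (^-+ (p 0F) a a′) (≋.*-cong (^-+ (p 1F) b b′) (≋.*-cong (^-+ (p 2F) c c′) (≋.sym (≋.*-identityˡ (C 1ℚ))))) ⟩
  (x * x′) * ((y * y′) * ((z * z′) * (u * u)))
    ≈⟨ regroup x x′ y y′ z z′ u u ⟩
  monomial p (a ∷ b ∷ c ∷ []) * monomial p (a′ ∷ b′ ∷ c′ ∷ []) ∎
  where
  open ≋-Reasoning
  x = p 0F ^ a
  x′ = p 0F ^ a′
  y = p 1F ^ b
  y′ = p 1F ^ b′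
  z = p 2F ^ c
  z′ = p 2F ^ c′
  u = C 1ℚ

  regroup : ∀ x x′ y y′ z z′ u u′ →
    (x * x′) * ((y * y′) * ((z * z′) * (u * u′))) ≋ (x * (y * (z * u))) * (x′ * (y′ * (z′ * u′)))
  regroup = solve-∀ poly

lin-substitute : ∀ F p f → lin F (substitute p f) ≡ lin (λ d → lin F (monomial p d)) f
lin-substitute F p []            = refl
lin-substitute F p ((c , d) ∷ f) =
  trans (lin-+ F (C c * monomial p d) (substitute p f))
        (cong₂ ℚ._+_ (lin-C* F c (monomial p d)) (lin-substitute F p f))

-- Multiplication by a fixed `g` is absorbed into the functional, after which `lin-substitute`
-- applies to the other factor.
lin-*-substitute : ∀ F g p f → lin F (g * substitute p f) ≡ lin (λ d → lin F (g * monomial p d)) f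
lin-*-substitute F g p f = begin
  lin F (g * substitute p f)                              ≡⟨ flip (substitute p f) ⟩
  lin (λ e → lin (λ d → F (d ⊕ e)) g) (substitute p f)    ≡⟨ lin-substitute _ p f ⟩
  lin (λ d → lin (λ e → lin (λ d → F (d ⊕ e)) g) (monomial p d)) f ≡⟨ lin-cong (λ d → flip (monomial p d)) f ⟨
  lin (λ d → lin F (g * monomial p d)) f                  ∎
  where
  open ≡-Reasoning
  flip : ∀ h → lin F (g * h) ≡ lin (λ e → lin (λ d → F (d ⊕ e)) g) h
  flip h = trans (lin-* F g h) (lin-swap (λ d e → F (d ⊕ e)) g h)

substitute-cong : ∀ p {f g} → f ≋ g → substitute p f ≋ substitute p g
substitute-cong p {f} {g} f≋g .lin-≡ F =
  trans (lin-substitute F p f) (trans (lin-≡ f≋g _) (sym (lin-substitute F p g)))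

substitute-congˡ : ∀ {p q} → (∀ k → p k ≋ q k) → ∀ f → substitute p f ≋ substitute q f
substitute-congˡ {p} {q} p≋q f .lin-≡ F = trans (lin-substitute F p f)
  (trans (lin-cong (λ d → lin-≡ (monomial-cong p≋q d) F) f) (sym (lin-substitute F q f)))

substitute-+ : ∀ p f g → substitute p (f + g) ≋ substitute p f + substitute p g
substitute-+ p f g .lin-≡ F = begin
  lin F (substitute p (f + g))                      ≡⟨ lin-substitute F p (f + g) ⟩
  lin _ (f + g)                                     ≡⟨ lin-+ _ f g ⟩
  lin _ f ℚ.+ lin _ g                               ≡⟨ cong₂ ℚ._+_ (lin-substitute F p f) (lin-substitute F p g) ⟨
  lin F (substitute p f) ℚ.+ lin F (substitute p g) ≡⟨ lin-+ F (substitute p f) (substitute p g) ⟨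
  lin F (substitute p f + substitute p g)           ∎
  where open ≡-Reasoning

substitute-neg : ∀ p f → substitute p (- f) ≋ - substitute p f
substitute-neg p f .lin-≡ F = begin
  lin F (substitute p (- f))        ≡⟨ lin-substitute F p (- f) ⟩
  lin _ (- f)                       ≡⟨ lin-neg _ f ⟩
  ℚ.- lin _ f                       ≡⟨ cong ℚ.-_ (lin-substitute F p f) ⟨
  ℚ.- lin F (substitute p f)        ≡⟨ lin-neg F (substitute p f) ⟨
  lin F (- substitute p f)          ∎
  where open ≡-Reasoning

substitute-* : ∀ p f g → substitute p (f * g) ≋ substitute p f * substitute p g
substitute-* p f g .lin-≡ F = begin
  lin F (substitute p (f * g))
    ≡⟨ lin-substitute F p (f * g) ⟩
  lin (λ d → lin F (monomial p d)) (f * g)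
    ≡⟨ lin-* _ f g ⟩
  lin (λ d → lin (λ e → lin F (monomial p (d ⊕ e))) g) f
    ≡⟨ lin-cong (λ d → lin-cong (λ e → lin-≡ (monomial-⊕ p d e) F) g) f ⟩
  lin (λ d → lin (λ e → lin F (monomial p d * monomial p e)) g) f
    ≡⟨ lin-cong (λ d → lin-*-substitute F (monomial p d) p g) f ⟨
  -- `lin-*-substitute` collects monomials only in the right-hand factor, hence the commutation here
  -- and its reversal at the end.
  lin (λ d → lin F (monomial p d * substitute p g)) f
    ≡⟨ lin-cong (λ d → lin-≡ (≋.*-comm (monomial p d) (substitute p g)) F) f ⟩
  lin (λ d → lin F (substitute p g * monomial p d)) f
    ≡⟨ lin-*-substitute F (substitute p g) p f ⟨
  lin F (substitute p g * substitute p f)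
    ≡⟨ lin-≡ (≋.*-comm (substitute p g) (substitute p f)) F ⟩
  lin F (substitute p f * substitute p g) ∎
  where open ≡-Reasoning

substitute-1 : ∀ p → substitute p (C 1ℚ) ≋ C 1ℚ
substitute-1 p = mk≋ λ F → refl

substitute-^ : ∀ p f n → substitute p (f ^ n) ≋ substitute p f ^ n
substitute-^ p f zero    = substitute-1 p
substitute-^ p f (suc n) =
  ≋.trans (substitute-* p f (f ^ n)) (≋.*-cong (≋.refl {substitute p f}) (substitute-^ p f n))

substitute-monomial : ∀ q p d → substitute q (monomial p d) ≋ monomial (λ k → substitute q (p k)) d
substitute-monomial q p (a ∷ b ∷ c ∷ []) =
  step a 0F (p 1F ^ b * (p 2F ^ c * C 1ℚ)) (step b 1F (p 2F ^ c * C 1ℚ) (step c 2F (C 1ℚ) (substitute-1 q)))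
  where
  step : ∀ n k f {g} → substitute q f ≋ g → substitute q (p k ^ n * f) ≋ substitute q (p k) ^ n * g
  step n k f eq = ≋.trans (substitute-* q (p k ^ n) f) (≋.*-cong (substitute-^ q (p k) n) eq)

substitute-substitute : ∀ q p f →
  substitute q (substitute p f) ≋ substitute (λ k → substitute q (p k)) f
substitute-substitute q p f .lin-≡ F = begin
  lin F (substitute q (substitute p f))                           ≡⟨ lin-substitute F q (substitute p f) ⟩
  lin (λ e → lin F (monomial q e)) (substitute p f)               ≡⟨ lin-substitute _ p f ⟩
  lin (λ d → lin (λ e → lin F (monomial q e)) (monomial p d)) f
    ≡⟨ lin-cong (λ d → lin-substitute F q (monomial p d)) f ⟨
  lin (λ d → lin F (substitute q (monomial p d))) f
    ≡⟨ lin-cong (λ d → lin-≡ (substitute-monomial q p d) F) f ⟩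
  lin (λ d → lin F (monomial (λ k → substitute q (p k)) d)) f     ≡⟨ lin-substitute F (λ k → substitute q (p k)) f ⟨
  lin F (substitute (λ k → substitute q (p k)) f)                 ∎
  where open ≡-Reasoning

lin-X* : ∀ F k g → lin F (X k * g) ≡ lin (λ e → F (Vec.updateAt e k suc)) g
lin-X* F k g = begin
  lin F (X k * g)                        ≡⟨ lin-* F (X k) g ⟩
  1ℚ ℚ.* lin (λ e → F (Vec.updateAt (Vec.replicate 3 0) k suc ⊕ e)) g ℚ.+ 0ℚ
    ≡⟨ trans (ℚ.+-identityʳ _) (ℚ.*-identityˡ _) ⟩
  lin (λ e → F (Vec.updateAt (Vec.replicate 3 0) k suc ⊕ e)) g  ≡⟨ lin-cong (λ e → cong F (shift k e)) g ⟩
  lin (λ e → F (Vec.updateAt e k suc)) g ∎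
  where
  open ≡-Reasoning
  shift : ∀ k e → Vec.updateAt (Vec.replicate 3 0) k suc ⊕ e ≡ Vec.updateAt e k suc
  shift 0F (a ∷ b ∷ c ∷ []) = refl
  shift 1F (a ∷ b ∷ c ∷ []) = refl
  shift 2F (a ∷ b ∷ c ∷ []) = refl

lin-X^* : ∀ F k n g → lin F (X k ^ n * g) ≡ lin (λ e → F (Vec.updateAt e k (n ℕ.+_))) g
lin-X^* F k zero    g = trans (lin-≡ (≋.*-identityˡ g) F)
  (lin-cong (λ e → cong F (sym (Vec.updateAt-id k e))) g)
lin-X^* F k (suc n) g = begin
  lin F (X k * X k ^ n * g)                              ≡⟨ lin-≡ (≋.*-assoc (X k) (X k ^ n) g) F ⟩
  lin F (X k * (X k ^ n * g))                            ≡⟨ lin-X* F k (X k ^ n * g) ⟩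
  lin (λ e → F (Vec.updateAt e k suc)) (X k ^ n * g)     ≡⟨ lin-X^* _ k n g ⟩
  lin (λ e → F (Vec.updateAt (Vec.updateAt e k (n ℕ.+_)) k suc)) g
    ≡⟨ lin-cong (λ e → cong F (Vec.updateAt-updateAt k e)) g ⟩
  lin (λ e → F (Vec.updateAt e k (suc n ℕ.+_))) g        ∎
  where
  open ≡-Reasoning

substitute-X-id : ∀ f → substitute X f ≋ f
substitute-X-id f .lin-≡ F = trans (lin-substitute F X f) (lin-cong monomial-X f)
  where
  monomial-X : ∀ d → lin F (monomial X d) ≡ F d
  monomial-X (a ∷ b ∷ c ∷ []) = begin
    lin F (monomial X (a ∷ b ∷ c ∷ []))   ≡⟨ lin-X^* F 0F a _ ⟩
    lin _ (X 1F ^ b * (X 2F ^ c * C 1ℚ))  ≡⟨ lin-X^* _ 1F b _ ⟩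
    lin _ (X 2F ^ c * C 1ℚ)               ≡⟨ lin-X^* _ 2F c (C 1ℚ) ⟩
    1ℚ ℚ.* F ((a ℕ.+ 0) ∷ (b ℕ.+ 0) ∷ (c ℕ.+ 0) ∷ []) ℚ.+ 0ℚ
      ≡⟨ trans (ℚ.+-identityʳ _) (ℚ.*-identityˡ _) ⟩
    F ((a ℕ.+ 0) ∷ (b ℕ.+ 0) ∷ (c ℕ.+ 0) ∷ [])
      ≡⟨ cong F (cong₂ _∷_ (ℕ.+-identityʳ a) (cong₂ _∷_ (ℕ.+-identityʳ b) (cong (_∷ []) (ℕ.+-identityʳ c)))) ⟩
    F (a ∷ b ∷ c ∷ []) ∎
    where open ≡-Reasoning

-- Literally the base of the sign in `ℋ^Γ₋`, so its powers match the eigenvalue condition.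
ε : Poly
ε = - C 1ℚ

ε*≋- : ∀ f → ε * f ≋ - f
ε*≋- f = ≋.trans (≋.sym (-‿distribˡ-* (C 1ℚ) f)) (≋.-‿cong (≋.*-identityˡ f))
  where open RingProperties ≋.ring using (-‿distribˡ-*)

neg-^ : ∀ f n → (- f) ^ n ≋ ε ^ n * f ^ n
neg-^ f n = ≋.trans (^-cong n (≋.sym (ε*≋- f))) (*-^ ε f n)

monomial-neg : ∀ p d → monomial (λ k → - p k) d ≋ ε ^ Vec.sum d * monomial p d
monomial-neg p (a ∷ b ∷ c ∷ []) = begin
  monomial (λ k → - p k) (a ∷ b ∷ c ∷ [])
    ≈⟨ ≋.*-cong (neg-^ (p 0F) a) (≋.*-cong (neg-^ (p 1F) b) (≋.*-cong (neg-^ (p 2F) c) (≋.refl {C 1ℚ}))) ⟩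
  (ε ^ a * p 0F ^ a) * ((ε ^ b * p 1F ^ b) * ((ε ^ c * p 2F ^ c) * C 1ℚ))
    ≈⟨ regroup (ε ^ a) (p 0F ^ a) (ε ^ b) (p 1F ^ b) (ε ^ c) (p 2F ^ c) (C 1ℚ) ⟩
  (ε ^ a * (ε ^ b * ε ^ c)) * monomial p (a ∷ b ∷ c ∷ [])
    ≈⟨ ≋.*-cong signs (≋.refl {monomial p (a ∷ b ∷ c ∷ [])}) ⟩
  ε ^ (a ℕ.+ (b ℕ.+ (c ℕ.+ 0))) * monomial p (a ∷ b ∷ c ∷ []) ∎
  where
  open ≋-Reasoning
  regroup : ∀ r x s y t z u → (r * x) * ((s * y) * ((t * z) * u)) ≋ (r * (s * t)) * (x * (y * (z * u)))
  regroup = solve-∀ poly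

  signs : ε ^ a * (ε ^ b * ε ^ c) ≋ ε ^ (a ℕ.+ (b ℕ.+ (c ℕ.+ 0)))
  signs rewrite ℕ.+-identityʳ c = ≋.sym
    (≋.trans (^-+ ε a (b ℕ.+ c)) (≋.*-cong (≋.refl {ε ^ a}) (^-+ ε b c)))

-- Each monomial of degree l contributes the sign (-1)ˡ. The list may hold cancelling terms of other
-- degrees; `lin-support` confines the comparison to exponents of nonzero coefficient, which
-- homogeneity controls.
substitute-neg-homogeneous : ∀ {l f} p → 𝒜 l f → substitute (λ k → - p k) f ≋ ε ^ l * substitute p f
substitute-neg-homogeneous {l} {f} p f∈𝒜 .lin-≡ F = begin
  lin F (substitute (λ k → - p k) f)               ≡⟨ lin-substitute F (λ k → - p k) f ⟩
  lin (λ d → lin F (monomial (λ k → - p k) d)) f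
    ≡⟨ lin-support f (λ d d∈f → subst (λ n → lin F (monomial (λ k → - p k) d) ≡ lin F (ε ^ n * monomial p d))
                                      (f∈𝒜 d d∈f) (lin-≡ (monomial-neg p d) F)) ⟩
  lin (λ d → lin F (ε ^ l * monomial p d)) f       ≡⟨ lin-*-substitute F (ε ^ l) p f ⟨
  lin F (ε ^ l * substitute p f)                   ∎
  where open ≡-Reasoning

-- Restriction to planes

infix 4 _≋?_
-- An exponent absent from the list f - g has coefficient 0 there, so finitely many coefficients
-- decide.
_≋?_ : Decidable _≋_
f ≋? g = map′ (λ zs → -≋0⇒≋ (≈0⇒≋0 h (vanishes zs)))
              (λ f≋g → All.universal (λ (_ , e) → coeffs f≋g e) h)
              (all? (λ (_ , e) → coeff h e ℚ.≟ 0ℚ) h)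
  where
  h = f - g

  coeffs : f ≋ g → ∀ e → coeff h e ≡ 0ℚ
  coeffs f≋g = ≋⇒≈ (≋.trans (≋.+-cong f≋g (≋.refl { - g})) (≋.-‿inverseʳ g))

  occurs : ∀ e h → coeff h e ≡ 0ℚ ⊎ Any ((_≡ e) ∘ proj₂) h
  occurs e []            = inj₁ refl
  occurs e ((c , d) ∷ h) with d ≟ᴱ e | occurs e h
  ... | yes d≡e | _      = inj₂ (here d≡e)
  ... | no _    | inj₁ z = inj₁ z
  ... | no _    | inj₂ o = inj₂ (there o)

  vanishes : All (λ (_ , e) → coeff h e ≡ 0ℚ) h → ∀ e → coeff h e ≡ 0ℚ
  vanishes zs e with occurs e h
  ... | inj₁ z = z
  ... | inj₂ o with z , at-e ← All.lookupAny zs o = subst (λ e → coeff h e ≡ 0ℚ) at-e z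

pointwise? : ∀ (p q : Fin 3 → Poly) → Dec (∀ k → p k ≋ q k)
pointwise? p q = Fin.all? λ k → p k ≋? q k

-- Being a non-zero-divisor is the cancellation property that the successive divisions use.
Regular : Poly → Set
Regular f = ∀ g → g * f ≋ [] → g ≋ []

regular-cong : ∀ {f g} → f ≋ g → Regular f → Regular g
regular-cong f≋g reg h hg≋0 = reg h (≋.trans (≋.*-cong (≋.refl {h}) f≋g) hg≋0)

regular-* : ∀ {f g} → Regular f → Regular g → Regular (f * g)
regular-* {f} {g} rf rg h eq = rf h (rg (h * f) (≋.trans (≋.*-assoc h f g) eq))

regular-C : ∀ c .{{_ : ℚ.NonZero c}} → Regular (C c)
regular-C c g gc≋0 .lin-≡ F = begin
  lin F g                               ≡⟨ ℚ.*-identityˡ _ ⟨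
  1ℚ ℚ.* lin F g                        ≡⟨ cong (ℚ._* lin F g) (ℚ.*-inverseˡ c) ⟨
  (ℚ.1/ c) ℚ.* c ℚ.* lin F g            ≡⟨ ℚ.*-assoc (ℚ.1/ c) c (lin F g) ⟩
  (ℚ.1/ c) ℚ.* (c ℚ.* lin F g)          ≡⟨ cong ((ℚ.1/ c) ℚ.*_) (lin-C* F c g) ⟨
  (ℚ.1/ c) ℚ.* lin F (C c * g)          ≡⟨ cong ((ℚ.1/ c) ℚ.*_) (lin-≡ (≋.trans (≋.*-comm (C c) g) gc≋0) F) ⟩
  (ℚ.1/ c) ℚ.* 0ℚ                       ≡⟨ ℚ.*-zeroʳ (ℚ.1/ c) ⟩
  0ℚ                                    ∎
  where open ≡-Reasoning

-- Lowering the k-th exponent inside the functional undoes multiplication by `X k`. The value of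
-- `pred` at 0 never enters, since that exponent has just been raised.
regular-X : ∀ k → Regular (X k)
regular-X k g gX≋0 .lin-≡ F = begin
  lin F g                                                         ≡⟨ lin-cong (λ e → cong F (lowered e)) g ⟨
  lin (λ e → F (Vec.updateAt (Vec.updateAt e k suc) k ℕ.pred)) g  ≡⟨ lin-X* _ k g ⟨
  lin (λ e → F (Vec.updateAt e k ℕ.pred)) (X k * g)
    ≡⟨ lin-≡ (≋.trans (≋.*-comm (X k) g) gX≋0) _ ⟩
  0ℚ ∎
  where
  open ≡-Reasoning
  lowered : ∀ e → Vec.updateAt (Vec.updateAt e k suc) k ℕ.pred ≡ e
  lowered e = trans (Vec.updateAt-updateAt k e) (Vec.updateAt-id k e)

-- The endomorphism given by `p` has the left inverse given by `q`, so it is injective, and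
-- regularity pulls back along it.
regular-substitute : ∀ p q {f} → (∀ k → substitute q (p k) ≋ X k) → Regular (substitute p f) → Regular f
regular-substitute p q {f} qp≋X reg g gf≋0 = begin
  g                              ≈⟨ substitute-X-id g ⟨
  substitute X g                 ≈⟨ substitute-congˡ {λ k → substitute q (p k)} {X} qp≋X g ⟨
  substitute (λ k → substitute q (p k)) g  ≈⟨ substitute-substitute q p g ⟨
  substitute q (substitute p g)
    ≈⟨ substitute-cong q (reg (substitute p g)
         (≋.trans (≋.sym (substitute-* p g f)) (substitute-cong p gf≋0))) ⟩
  []                             ∎
  where open ≋-Reasoning

-- Congruences and division by a linear form

infix 4 _≡_mod_
_≡_mod_ : Poly → Poly → Poly → Set
f ≡ g mod h = ∃[ r ] f ≋ g + r * h

module _ {h : Poly} where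

  ≋⇒mod : ∀ {f g} → f ≋ g → f ≡ g mod h
  ≋⇒mod {f} {g} f≋g = [] , ≋.trans f≋g (≋.sym (≋.+-identityʳ g))

  +-mod : ∀ {f f′ g g′} → f ≡ f′ mod h → g ≡ g′ mod h → f + g ≡ f′ + g′ mod h
  +-mod {f} {f′} {g} {g′} (r , p) (s , q) =
    r + s , ≋.trans (≋.+-cong p q) (identity f′ g′ r s h)
    where
    identity : ∀ f g r s h → (f + r * h) + (g + s * h) ≋ (f + g) + (r + s) * h
    identity = solve-∀ poly

  *-mod : ∀ {f f′ g g′} → f ≡ f′ mod h → g ≡ g′ mod h → f * g ≡ f′ * g′ mod h
  *-mod {f} {f′} {g} {g′} (r , p) (s , q) =
    f′ * s + r * g′ + r * s * h , ≋.trans (≋.*-cong p q) (identity f′ g′ r s h)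
    where
    identity : ∀ f g r s h → (f + r * h) * (g + s * h) ≋ f * g + (f * s + r * g + r * s * h) * h
    identity = solve-∀ poly

  ^-mod : ∀ {f g} n → f ≡ g mod h → f ^ n ≡ g ^ n mod h
  ^-mod zero    f≡g = ≋⇒mod ≋.refl
  ^-mod {f} {g} (suc n) f≡g = *-mod {f} {g} {f ^ n} {g ^ n} f≡g (^-mod n f≡g)

  monomial-mod : ∀ {p q} → (∀ k → p k ≡ q k mod h) → ∀ d → monomial p d ≡ monomial q d mod h
  monomial-mod {p} {q} p≡q (a ∷ b ∷ c ∷ []) =
    step 0F a (step 1F b (step 2F c (≋⇒mod (≋.refl {C 1ℚ}))))
    where
    step : ∀ k n {f g} → f ≡ g mod h → p k ^ n * f ≡ q k ^ n * g mod h
    step k n {f} {g} = *-mod {p k ^ n} {q k ^ n} {f} {g} (^-mod n (p≡q k))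

  -- With p = `X` and q = `π` this is the remainder theorem for a linear form: f is congruent to its
  -- restriction.
  substitute-mod : ∀ {p q} → (∀ k → p k ≡ q k mod h) → ∀ f → substitute p f ≡ substitute q f mod h
  substitute-mod         p≡q []            = ≋⇒mod ≋.refl
  substitute-mod {p} {q} p≡q ((c , d) ∷ f) =
    +-mod {C c * monomial p d} {C c * monomial q d}
      (*-mod {C c} {C c} {monomial p d} {monomial q d} (≋⇒mod ≋.refl) (monomial-mod p≡q d))
      (substitute-mod p≡q f)

-- `π` is meant to eliminate one variable by setting the form to zero, so that restriction to the
-- plane stays in the same polynomial ring. `residue` says that each variable is congruent to its
-- image modulo the form.
record Plane : Set where
  constructor plane
  field
    form    : Poly
    π       : Fin 3 → Poly
    slope   : Fin 3 → ℚ
    residue : ∀ k → X k ≋ π k + C (slope k) * form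

  restrict : Poly → Poly
  restrict = substitute π

  divide : ∀ f → restrict f ≋ [] → ∃[ r ] f ≋ r * form
  divide f πf≋0 with r , eq ← substitute-mod {form} {X} {π} (λ k → C (slope k) , residue k) f =
    r , ≋.trans (≋.sym (substitute-X-id f)) (≋.trans eq (≋.+-cong πf≋0 (≋.refl {r * form})))

  divide-cofactor : ∀ {f} h → Regular (restrict h) → restrict f ≋ [] →
    ∃[ g ] f ≋ g * h → ∃[ r ] f ≋ r * (h * form)
  divide-cofactor {f} h reg πf≋0 (g , f≋gh)
    with r , eq ← divide g (reg (restrict g) (≋.trans (≋.sym (substitute-* π g h))
                     (≋.trans (≋.sym (substitute-cong π f≋gh)) πf≋0))) =
    r , ≋.trans f≋gh (≋.trans (≋.*-cong eq (≋.refl {h})) (identity r form h))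
    where
    identity : ∀ r l h → r * l * h ≋ r * (h * l)
    identity = solve-∀ poly

-- The equation says (q + 1)f = 0. Both divisibility statements end here: q = 1 for odd l, and q is
-- the number of representatives for T₂.
nonNeg-multiple≋neg⇒0 : ∀ {q} f → 0ℚ ℚ.≤ q → C q * f ≋ - f → f ≋ []
nonNeg-multiple≋neg⇒0 {q} f 0≤q eq =
  regular-C (q ℚ.+ 1ℚ) {{ℚ.pos⇒nonZero (q ℚ.+ 1ℚ) {{q+1>0}}}} f (mk≋ λ F → begin
    lin F (f * C (q ℚ.+ 1ℚ))        ≡⟨ lin-≡ (≋.*-comm f (C (q ℚ.+ 1ℚ))) F ⟩
    lin F (C (q ℚ.+ 1ℚ) * f)        ≡⟨ lin-C* F (q ℚ.+ 1ℚ) f ⟩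
    (q ℚ.+ 1ℚ) ℚ.* lin F f          ≡⟨ solve 2 (λ q x → (q :+ con 1ℚ) :* x := q :* x :+ x) refl q (lin F f) ⟩
    q ℚ.* lin F f ℚ.+ lin F f       ≡⟨ cong (ℚ._+ lin F f) (lin-C* F q f) ⟨
    lin F (C q * f) ℚ.+ lin F f     ≡⟨ cong (ℚ._+ lin F f) (trans (lin-≡ eq F) (lin-neg F f)) ⟩
    ℚ.- lin F f ℚ.+ lin F f         ≡⟨ ℚ.+-inverseˡ (lin F f) ⟩
    0ℚ                              ∎)
  where
  open ≡-Reasoning
  q+1>0 : ℚ.Positive (q ℚ.+ 1ℚ)
  q+1>0 = ℚ.positive (ℚ.+-mono-≤-< 0≤q (ℚ.positive⁻¹ 1ℚ))

-- Matrices acting by substitution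

image : Matrix → Fin 3 → Poly
image A k = sum λ m → X m * C (A m k)

lin-image : ∀ F A k → lin F (image A k) ≡
  lin F (X 0F) ℚ.* A 0F k ℚ.+ (lin F (X 1F) ℚ.* A 1F k ℚ.+ lin F (X 2F) ℚ.* A 2F k)
lin-image F A k = solve 6 (λ x y z a b c →
    con 1ℚ :* a :* x :+ (con 1ℚ :* b :* y :+ (con 1ℚ :* c :* z :+ con 0ℚ))
      := (con 1ℚ :* x :+ con 0ℚ) :* a :+ ((con 1ℚ :* y :+ con 0ℚ) :* b :+ (con 1ℚ :* z :+ con 0ℚ) :* c))
  refl _ _ _ (A 0F k) (A 1F k) (A 2F k)

substitute-C : ∀ p c → substitute p (C c) ≋ C c
substitute-C p c .lin-≡ F =
  solve 2 (λ c x → c :* con 1ℚ :* x :+ con 0ℚ := c :* x :+ con 0ℚ) refl c (F (Vec.replicate 3 0))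

substitute-X : ∀ p k → substitute p (X k) ≋ p k
substitute-X p k .lin-≡ F = trans (lin-substitute F p (X k))
  (trans (ℚ.+-identityʳ _) (trans (ℚ.*-identityˡ _) (lin-≡ (unit k) F)))
  where
  drop-1 : ∀ f → f * C 1ℚ * C 1ℚ ≋ f
  drop-1 f = ≋.trans (≋.*-identityʳ (f * C 1ℚ)) (≋.*-identityʳ f)

  unit : ∀ k → monomial p (Vec.updateAt (Vec.replicate 3 0) k suc) ≋ p k
  unit 0F = drop-1 (p 0F)
  unit 1F = ≋.trans (≋.*-identityˡ (p 1F * C 1ℚ * C 1ℚ)) (drop-1 (p 1F))
  unit 2F = ≋.trans (≋.*-identityˡ (C 1ℚ * (p 2F * C 1ℚ * C 1ℚ)))
              (≋.trans (≋.*-identityˡ (p 2F * C 1ℚ * C 1ℚ)) (drop-1 (p 2F)))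

-- Matrices act on rows from the right: x ↦ f(xB) evaluated at xA is f(xAB).
∘ᴹ-· : ∀ f A B → (f ∘ᴹ B) ∘ᴹ A ≋ f ∘ᴹ (A · B)
∘ᴹ-· f A B = ≋.trans (substitute-substitute (image A) (image B) f) (substitute-congˡ {λ k → substitute (image A) (image B k)} {image (A · B)} composed f)
  where
  term : ∀ k m → substitute (image A) (X m * C (B m k)) ≋ image A m * C (B m k)
  term k m = ≋.trans (substitute-* (image A) (X m) (C (B m k)))
    (≋.*-cong (substitute-X (image A) m) (substitute-C (image A) (B m k)))

  expand : ∀ k → substitute (image A) (image B k) ≋
    image A 0F * C (B 0F k) + (image A 1F * C (B 1F k) + (image A 2F * C (B 2F k) + []))
  expand k = ≋.trans (substitute-+ (image A) (X 0F * C (B 0F k)) (X 1F * C (B 1F k) + (X 2F * C (B 2F k) + [])))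
    (≋.+-cong (term k 0F) (≋.trans (substitute-+ (image A) (X 1F * C (B 1F k)) (X 2F * C (B 2F k) + []))
    (≋.+-cong (term k 1F) (≋.trans (substitute-+ (image A) (X 2F * C (B 2F k)) [])
    (≋.+-cong (term k 2F) ≋.refl)))))

  composed : ∀ k → substitute (image A) (image B k) ≋ image (A · B) k
  composed k = ≋.trans (expand k) (mk≋ eval)
    where
    lin-*C : ∀ F g c {x} → lin F g ≡ x → lin F (g * C c) ≡ c ℚ.* x
    lin-*C F g c eq = trans (lin-≡ (≋.*-comm g (C c)) F) (trans (lin-C* F c g) (cong (c ℚ.*_) eq))

    lin-sum : ∀ F f g h → lin F (f + (g + (h + []))) ≡ lin F f ℚ.+ (lin F g ℚ.+ (lin F h ℚ.+ 0ℚ))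
    lin-sum F f g h = trans (lin-+ F f (g + (h + []))) (cong (lin F f ℚ.+_)
      (trans (lin-+ F g (h + [])) (cong (lin F g ℚ.+_) (lin-+ F h []))))

    -- Here x, y, z are the values of a functional on the three variables; what remains is
    -- associativity of the matrix action.
    associate : ∀ x y z a₀₀ a₀₁ a₀₂ a₁₀ a₁₁ a₁₂ a₂₀ a₂₁ a₂₂ b₀ b₁ b₂ →
      b₀ ℚ.* (x ℚ.* a₀₀ ℚ.+ (y ℚ.* a₁₀ ℚ.+ z ℚ.* a₂₀)) ℚ.+
        (b₁ ℚ.* (x ℚ.* a₀₁ ℚ.+ (y ℚ.* a₁₁ ℚ.+ z ℚ.* a₂₁)) ℚ.+
          (b₂ ℚ.* (x ℚ.* a₀₂ ℚ.+ (y ℚ.* a₁₂ ℚ.+ z ℚ.* a₂₂)) ℚ.+ 0ℚ))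
      ≡ x ℚ.* (a₀₀ ℚ.* b₀ ℚ.+ (a₀₁ ℚ.* b₁ ℚ.+ (a₀₂ ℚ.* b₂ ℚ.+ 0ℚ))) ℚ.+
        (y ℚ.* (a₁₀ ℚ.* b₀ ℚ.+ (a₁₁ ℚ.* b₁ ℚ.+ (a₁₂ ℚ.* b₂ ℚ.+ 0ℚ))) ℚ.+
         z ℚ.* (a₂₀ ℚ.* b₀ ℚ.+ (a₂₁ ℚ.* b₁ ℚ.+ (a₂₂ ℚ.* b₂ ℚ.+ 0ℚ))))
    associate = solve 15 (λ x y z a₀₀ a₀₁ a₀₂ a₁₀ a₁₁ a₁₂ a₂₀ a₂₁ a₂₂ b₀ b₁ b₂ →
          b₀ :* (x :* a₀₀ :+ (y :* a₁₀ :+ z :* a₂₀)) :+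
            (b₁ :* (x :* a₀₁ :+ (y :* a₁₁ :+ z :* a₂₁)) :+ (b₂ :* (x :* a₀₂ :+ (y :* a₁₂ :+ z :* a₂₂)) :+ con 0ℚ))
          := x :* (a₀₀ :* b₀ :+ (a₀₁ :* b₁ :+ (a₀₂ :* b₂ :+ con 0ℚ))) :+
            (y :* (a₁₀ :* b₀ :+ (a₁₁ :* b₁ :+ (a₁₂ :* b₂ :+ con 0ℚ))) :+
             z :* (a₂₀ :* b₀ :+ (a₂₁ :* b₁ :+ (a₂₂ :* b₂ :+ con 0ℚ)))))
          refl

    eval : ∀ F → lin F (image A 0F * C (B 0F k) + (image A 1F * C (B 1F k) + (image A 2F * C (B 2F k) + [])))
      ≡ lin F (image (A · B) k)
    eval F = trans (lin-sum F (image A 0F * C (B 0F k)) (image A 1F * C (B 1F k)) (image A 2F * C (B 2F k)))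
      (trans (cong₂ ℚ._+_ (lin-*C F (image A 0F) (B 0F k) (lin-image F A 0F))
        (cong₂ ℚ._+_ (lin-*C F (image A 1F) (B 1F k) (lin-image F A 1F))
        (cong₂ ℚ._+_ (lin-*C F (image A 2F) (B 2F k) (lin-image F A 2F)) refl)))
      (trans (associate (lin F (X 0F)) (lin F (X 1F)) (lin F (X 2F))
          (A 0F 0F) (A 0F 1F) (A 0F 2F) (A 1F 0F) (A 1F 1F) (A 1F 2F) (A 2F 0F) (A 2F 1F) (A 2F 2F)
          (B 0F k) (B 1F k) (B 2F k))
      (sym (lin-image F (A · B) k))))

-- A acts as −1 on the plane P, as the half-turn about its normal does.
HalfTurn : Plane → Matrix → Set
HalfTurn P A = ∀ k → Plane.restrict P (image A k) ≋ - Plane.π P k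

restrict-∘ᴹ-halfTurn : ∀ P A → HalfTurn P A → ∀ {l} f → 𝒜 l f →
  Plane.restrict P (f ∘ᴹ A) ≋ ε ^ l * Plane.restrict P f
restrict-∘ᴹ-halfTurn P A turn {l} f f∈𝒜 = begin
  restrict (f ∘ᴹ A)                            ≈⟨ substitute-substitute π (image A) f ⟩
  substitute (λ k → restrict (image A k)) f    ≈⟨ substitute-congˡ {λ k → restrict (image A k)} {λ k → - π k} turn f ⟩
  substitute (λ k → - π k) f                   ≈⟨ substitute-neg-homogeneous {l} {f} π f∈𝒜 ⟩
  ε ^ l * restrict f                           ∎
  where
  open Plane P
  open ≋-Reasoning

open Plane

-- The implicit `True` argument is filled in once the decision evaluates to yes, so identities of
-- concrete polynomials hold by computation.
decide : ∀ {f g} {_ : True (f ≋? g)} → f ≋ g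
decide {f} {g} {f≋g} = toWitness {a? = f ≋? g} f≋g

decide₃ : ∀ {p q : Fin 3 → Poly} {_ : True (pointwise? p q)} → ∀ k → p k ≋ q k
decide₃ {p} {q} {p≋q} = toWitness {a? = pointwise? p q} p≋q

ε²≋1 : ∀ l f → ε ^ l * (ε ^ l * f) ≋ f
ε²≋1 zero    f = ≋.trans (≋.*-identityˡ (C 1ℚ * f)) (≋.*-identityˡ f)
ε²≋1 (suc l) f = begin
  ε * ε ^ l * (ε * ε ^ l * f)        ≈⟨ regroup ε (ε ^ l) f ⟩
  ε * ε * (ε ^ l * (ε ^ l * f))      ≈⟨ ≋.*-cong (decide {ε * ε} {C 1ℚ}) (ε²≋1 l f) ⟩
  C 1ℚ * f                           ≈⟨ ≋.*-identityˡ f ⟩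
  f                                  ∎
  where
  open ≋-Reasoning
  regroup : ∀ e s f → e * s * (e * s * f) ≋ e * e * (s * (s * f))
  regroup = solve-∀ poly

odd-ε : ∀ {l} → (∃[ k ] l ≡ 2 ℕ.* k ℕ.+ 1) → ∀ f → ε ^ l * f ≋ - f
odd-ε (k , refl) f = begin
  ε ^ (k ℕ.+ (k ℕ.+ 0) ℕ.+ 1) * f    ≡⟨ cong (λ n → ε ^ n * f) exponent ⟩
  ε * ε ^ (k ℕ.+ k) * f              ≈⟨ ≋.*-assoc ε (ε ^ (k ℕ.+ k)) f ⟩
  ε * (ε ^ (k ℕ.+ k) * f)            ≈⟨ ε*≋- (ε ^ (k ℕ.+ k) * f) ⟩
  - (ε ^ (k ℕ.+ k) * f)              ≈⟨ ≋.-‿cong (≋.*-cong (^-+ ε k k) (≋.refl {f})) ⟩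
  - (ε ^ k * ε ^ k * f)              ≈⟨ ≋.-‿cong (≋.trans (≋.*-assoc (ε ^ k) (ε ^ k) f) (ε²≋1 k f)) ⟩
  - f                                ∎
  where
  open ≋-Reasoning
  exponent : k ℕ.+ (k ℕ.+ 0) ℕ.+ 1 ≡ suc (k ℕ.+ k)
  exponent = trans (ℕ.+-comm (k ℕ.+ (k ℕ.+ 0)) 1) (cong (λ n → suc (k ℕ.+ n)) (ℕ.+-identityʳ k))

substitute-ε^* : ∀ p l f → substitute p (ε ^ l * f) ≋ ε ^ l * substitute p f
substitute-ε^* p l f = ≋.trans (substitute-* p (ε ^ l) f)
  (≋.*-cong (≋.trans (substitute-^ p ε l) (^-cong l (substitute-C p (ℚ.- 1ℚ)))) (≋.refl {substitute p f}))

restrict-odd : ∀ {l f} → (∃[ k ] l ≡ 2 ℕ.* k ℕ.+ 1) → ℋ^Γ l f →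
  ∀ P γ → Γ γ → HalfTurn P γ → restrict P f ≋ []
restrict-odd {l} {f} odd ((f∈𝒜 , _) , invariant) P γ γ∈Γ turn =
  nonNeg-multiple≋neg⇒0 (restrict P f) (ℚ.nonNegative⁻¹ 1ℚ) (begin
    C 1ℚ * restrict P f        ≈⟨ ≋.*-identityˡ (restrict P f) ⟩
    restrict P f               ≈⟨ substitute-cong (π P) (≈⇒≋ {f ∘ᴹ γ} {f} (invariant γ γ∈Γ)) ⟨
    restrict P (f ∘ᴹ γ)        ≈⟨ restrict-∘ᴹ-halfTurn P γ turn f f∈𝒜 ⟩
    ε ^ l * restrict P f       ≈⟨ odd-ε odd (restrict P f) ⟩
    - restrict P f             ∎)
  where open ≋-Reasoning

-- The eigenvalue equation of T₂ on a plane

module _ (A : Matrix) (A·ρ⁻¹∈Γ : ∀ ρ → 𝔗₂ (matrix ρ) → Γ (A · inverse ρ)) where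

  -- Each summand f(xρ⁻¹) becomes f(xAρ⁻¹) = f(x) by invariance, so q counts the list. An arbitrary
  -- list is taken for the sake of the induction.
  T₂∘A : ∀ f → (∀ γ → Γ γ → f ∘ᴹ γ ≈ f) → ∀ ρs → All (λ ρ → 𝔗₂ (matrix ρ)) ρs →
    ∃[ q ] 0ℚ ℚ.≤ q × List.foldr (λ ρ g → f ∘ᴹ inverse ρ + g) [] ρs ∘ᴹ A ≋ C q * f
  T₂∘A f invariant []       []             = 0ℚ , ℚ.≤-refl , mk≋ λ F →
    trans (sym (ℚ.*-zeroˡ (lin F f))) (sym (lin-C* F 0ℚ f))
  T₂∘A f invariant (ρ ∷ ρs) (ρ∈𝔗₂ ∷ ρs∈𝔗₂) =
    let q , 0≤q , ih = T₂∘A f invariant ρs ρs∈𝔗₂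
    in 1ℚ ℚ.+ q , ℚ.+-mono-≤ (ℚ.nonNegative⁻¹ 1ℚ) 0≤q ,
       step q (List.foldr (λ ρ g → f ∘ᴹ inverse ρ + g) [] ρs) ih
    where
    open ≋-Reasoning

    count : ∀ q → f + C q * f ≋ C (1ℚ ℚ.+ q) * f
    count q .lin-≡ F = trans (lin-+ F f (C q * f))
      (trans (cong₂ ℚ._+_ (sym (ℚ.*-identityˡ (lin F f))) (lin-C* F q f))
      (trans (sym (ℚ.*-distribʳ-+ (lin F f) 1ℚ q)) (sym (lin-C* F (1ℚ ℚ.+ q) f))))

    step : ∀ q g → g ∘ᴹ A ≋ C q * f → (f ∘ᴹ inverse ρ + g) ∘ᴹ A ≋ C (1ℚ ℚ.+ q) * f
    step q g ih = begin
      (f ∘ᴹ inverse ρ + g) ∘ᴹ A             ≈⟨ substitute-+ (image A) (f ∘ᴹ inverse ρ) g ⟩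
      (f ∘ᴹ inverse ρ) ∘ᴹ A + g ∘ᴹ A        ≈⟨ ≋.+-cong (∘ᴹ-· f A (inverse ρ)) ih ⟩
      f ∘ᴹ (A · inverse ρ) + C q * f
        ≈⟨ ≋.+-cong (≈⇒≋ {f ∘ᴹ (A · inverse ρ)} {f} (invariant (A · inverse ρ) (A·ρ⁻¹∈Γ ρ ρ∈𝔗₂))) (≋.refl {C q * f}) ⟩
      f + C q * f                           ≈⟨ count q ⟩
      C (1ℚ ℚ.+ q) * f                      ∎

  -- T₂f composed with A is qf by counting and -(-1)ˡ f∘A by the eigenvalue equation. On the plane
  -- f∘A is (-1)ˡ f, the two signs cancel, and qf = -f remains.
  restrict-minus : ∀ {R l f} → ℋ^Γ₋ R l f →
    ∀ P γ → Γ γ → HalfTurn P (A · γ) → restrict P f ≋ []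
  restrict-minus {R} {l} {f} (((f∈𝒜 , _) , invariant) , T₂f≈) P γ γ∈Γ turn =
    let q , 0≤q , T₂f∘A = T₂∘A f invariant (Transversal.representatives R) (Transversal.in-S R)
    in nonNeg-multiple≋neg⇒0 (restrict P f) 0≤q (eigenvalue q T₂f∘A)
    where
    open ≋-Reasoning

    -- This exchanges A, which need not be a half-turn, for one that is.
    f∘A : f ∘ᴹ A ≋ f ∘ᴹ (A · γ)
    f∘A = ≋.trans (substitute-cong (image A) (≋.sym (≈⇒≋ {f ∘ᴹ γ} {f} (invariant γ γ∈Γ)))) (∘ᴹ-· f A γ)

    eigenvalue : ∀ q → T₂ R f ∘ᴹ A ≋ C q * f → C q * restrict P f ≋ - restrict P f
    eigenvalue q T₂f∘A = begin
      C q * restrict P f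
        ≈⟨ ≋.*-cong (substitute-C (π P) q) (≋.refl {restrict P f}) ⟨
      restrict P (C q) * restrict P f               ≈⟨ substitute-* (π P) (C q) f ⟨
      restrict P (C q * f)                          ≈⟨ substitute-cong (π P) T₂f∘A ⟨
      restrict P (T₂ R f ∘ᴹ A)
        ≈⟨ substitute-cong (π P) (substitute-cong (image A) (≈⇒≋ {T₂ R f} { - (ε ^ l * f)} T₂f≈)) ⟩
      restrict P ((- (ε ^ l * f)) ∘ᴹ A)
        ≈⟨ substitute-cong (π P) (≋.trans (substitute-neg (image A) (ε ^ l * f))
             (≋.-‿cong (substitute-ε^* (image A) l f))) ⟩
      restrict P (- (ε ^ l * f ∘ᴹ A))
        ≈⟨ ≋.trans (substitute-neg (π P) (ε ^ l * f ∘ᴹ A)) (≋.-‿cong (substitute-ε^* (π P) l (f ∘ᴹ A))) ⟩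
      - (ε ^ l * restrict P (f ∘ᴹ A))
        ≈⟨ ≋.-‿cong (≋.*-cong (≋.refl {ε ^ l}) (≋.trans (substitute-cong (π P) f∘A) (restrict-∘ᴹ-halfTurn P (A · γ) turn f f∈𝒜))) ⟩
      - (ε ^ l * (ε ^ l * restrict P f))            ≈⟨ ≋.-‿cong (ε²≋1 l (restrict P f)) ⟩
      - restrict P f                                ∎

-- For u = j, ij, w and the units of γ₁, γ₂, γ₃ the product (1 + i)u is j + ij,
-- ij − j, i + ij, i − ij, i + j and i − j respectively.
γ-i γ-j γ-ij γ-w γ₁ γ₂ γ₃ : Matrix
γ-i  = hurwitzMatrix 0ℤ 1ℤ 0ℤ 0ℤ
γ-j  = hurwitzMatrix 0ℤ 0ℤ 1ℤ 0ℤ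
γ-ij = hurwitzMatrix -1ℤ -1ℤ -1ℤ (+ 2)
γ-w  = hurwitzMatrix 0ℤ 0ℤ 0ℤ 1ℤ
γ₁   = hurwitzMatrix 1ℤ 1ℤ 0ℤ -1ℤ
γ₂   = hurwitzMatrix 1ℤ 1ℤ 1ℤ -1ℤ
γ₃   = hurwitzMatrix 0ℤ 0ℤ -1ℤ 1ℤ

γ-i∈Γ : Γ γ-i
γ-i∈Γ = hurwitzMatrix∈Γ 0ℤ 1ℤ 0ℤ 0ℤ refl refl refl refl refl

γ-j∈Γ : Γ γ-j
γ-j∈Γ = hurwitzMatrix∈Γ 0ℤ 0ℤ 1ℤ 0ℤ refl refl refl refl refl

γ-ij∈Γ : Γ γ-ij
-- The coefficients express ij = -1 - i - j + 2w.
γ-ij∈Γ = hurwitzMatrix∈Γ -1ℤ -1ℤ -1ℤ (+ 2) refl refl refl refl refl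

γ-w∈Γ : Γ γ-w
γ-w∈Γ = hurwitzMatrix∈Γ 0ℤ 0ℤ 0ℤ 1ℤ refl refl refl refl refl

γ₁∈Γ : Γ γ₁
γ₁∈Γ = hurwitzMatrix∈Γ 1ℤ 1ℤ 0ℤ -1ℤ refl refl refl refl refl

γ₂∈Γ : Γ γ₂
γ₂∈Γ = hurwitzMatrix∈Γ 1ℤ 1ℤ 1ℤ -1ℤ refl refl refl refl refl

γ₃∈Γ : Γ γ₃
γ₃∈Γ = hurwitzMatrix∈Γ 0ℤ 0ℤ -1ℤ 1ℤ refl refl refl refl refl

-- The nine planes and the successive divisions

y₁ y₂ y₃ : Poly
y₁ = - X 0F + X 1F + X 2F
y₂ = X 0F - X 1F + X 2F
y₃ = X 0F + X 1F - X 2F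

-- The slope of the eliminated variable is the sign with which it occurs in the form; the other two
-- variables are unchanged and have slope 0.
y₁=0 y₂=0 y₃=0 x₁=0 x₂=0 x₃=0 x₁=x₂ x₂=x₃ x₃=x₁ : Plane
y₁=0  = plane y₁ (Vec.lookup (X 1F + X 2F ∷ X 1F ∷ X 2F ∷ [])) (Vec.lookup (ℚ.- 1ℚ ∷ 0ℚ ∷ 0ℚ ∷ [])) decide₃
y₂=0  = plane y₂ (Vec.lookup (X 0F ∷ X 0F + X 2F ∷ X 2F ∷ [])) (Vec.lookup (0ℚ ∷ ℚ.- 1ℚ ∷ 0ℚ ∷ [])) decide₃
y₃=0  = plane y₃ (Vec.lookup (X 0F ∷ X 1F ∷ X 0F + X 1F ∷ [])) (Vec.lookup (0ℚ ∷ 0ℚ ∷ ℚ.- 1ℚ ∷ [])) decide₃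
x₁=0  = plane (X 0F) (Vec.lookup ([] ∷ X 1F ∷ X 2F ∷ [])) (Vec.lookup (1ℚ ∷ 0ℚ ∷ 0ℚ ∷ [])) decide₃
x₂=0  = plane (X 1F) (Vec.lookup (X 0F ∷ [] ∷ X 2F ∷ [])) (Vec.lookup (0ℚ ∷ 1ℚ ∷ 0ℚ ∷ [])) decide₃
x₃=0  = plane (X 2F) (Vec.lookup (X 0F ∷ X 1F ∷ [] ∷ [])) (Vec.lookup (0ℚ ∷ 0ℚ ∷ 1ℚ ∷ [])) decide₃
x₁=x₂ = plane (X 0F - X 1F) (Vec.lookup (X 0F ∷ X 0F ∷ X 2F ∷ [])) (Vec.lookup (0ℚ ∷ ℚ.- 1ℚ ∷ 0ℚ ∷ [])) decide₃
x₂=x₃ = plane (X 1F - X 2F) (Vec.lookup (X 0F ∷ X 1F ∷ X 1F ∷ [])) (Vec.lookup (0ℚ ∷ 0ℚ ∷ ℚ.- 1ℚ ∷ [])) decide₃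
x₃=x₁ = plane (X 2F - X 0F) (Vec.lookup (X 0F ∷ X 1F ∷ X 0F ∷ [])) (Vec.lookup (0ℚ ∷ 0ℚ ∷ 1ℚ ∷ [])) decide₃

-- The change of variable x₁ ↦ x₁ + x₂ turns x₁ - x₂ into x₁, and x₁ ↦ x₁ - x₂ reverses it.
regular-X₀-X₁ : Regular (X 0F - X 1F)
regular-X₀-X₁ = regular-substitute (Vec.lookup (X 0F + X 1F ∷ X 1F ∷ X 2F ∷ [])) (Vec.lookup (X 0F - X 1F ∷ X 1F ∷ X 2F ∷ []))
  {X 0F - X 1F} decide₃ (regular-cong {X 0F} decide (regular-X 0F))

f₃₊-divides : ∀ {l f} → (∃[ k ] l ≡ 2 ℕ.* k ℕ.+ 1) → ℋ^Γ l f → f₃₊ ∣ f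
f₃₊-divides {l} {f} odd f∈ℋ =
  conclude
    (divide-cofactor y₃=0 (y₁ * y₂) regular₃ (vanishes y₃=0 γ-ij γ-ij∈Γ decide₃)
    (divide-cofactor y₂=0 y₁ regular₂ (vanishes y₂=0 γ-j γ-j∈Γ decide₃)
    (divide y₁=0 f (vanishes y₁=0 γ-i γ-i∈Γ decide₃))))
  where
  negate : ∀ r h → (- r) * (- h) ≋ r * h
  negate = solve-∀ poly

  conclude : ∃[ r ] f ≋ r * (y₁ * y₂ * y₃) → f₃₊ ∣ f
  -- `f₃₊` is minus the product of the three forms; the sign moves into the quotient.
  conclude (r , f≋) = record { quotient = - r ; equality = ≋⇒≈ (≋.trans (negate r (y₁ * y₂ * y₃)) (≋.sym f≋)) }

  vanishes : ∀ P γ → Γ γ → HalfTurn P γ → restrict P f ≋ []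
  vanishes = restrict-odd {l} {f} odd f∈ℋ

  -- Two of the forms y₁, y₂, y₃ add up to twice a variable, so on the plane of one the other
  -- restricts to twice that variable.
  regular-2X : ∀ k → Regular (C (1ℚ ℚ.+ 1ℚ) * X k)
  regular-2X k = regular-* {C (1ℚ ℚ.+ 1ℚ)} {X k} (regular-C (1ℚ ℚ.+ 1ℚ)) (regular-X k)

  regular₂ : Regular (restrict y₂=0 y₁)
  regular₂ = regular-cong {C (1ℚ ℚ.+ 1ℚ) * X 2F} decide (regular-2X 2F)

  regular₃ : Regular (restrict y₃=0 (y₁ * y₂))
  regular₃ = regular-cong {C (1ℚ ℚ.+ 1ℚ) * X 1F * (C (1ℚ ℚ.+ 1ℚ) * X 0F)} decide
    (regular-* {C (1ℚ ℚ.+ 1ℚ) * X 1F} {C (1ℚ ℚ.+ 1ℚ) * X 0F} (regular-2X 1F) (regular-2X 0F))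

f₆₋-divides : ∀ {R l f} → ℋ^Γ₋ R l f → f₆₋ ∣ f
f₆₋-divides {R} {l} {f} f∈ℋ =
  conclude
    (divide-cofactor x₃=x₁ (X 0F * X 1F * X 2F * (X 0F - X 1F) * (X 1F - X 2F)) regular₆ (vanishes x₃=x₁ γ₁ γ₁∈Γ decide₃)
    (divide-cofactor x₂=x₃ (X 0F * X 1F * X 2F * (X 0F - X 1F)) regular₅ (vanishes x₂=x₃ γ-ij γ-ij∈Γ decide₃)
    (divide-cofactor x₁=x₂ (X 0F * X 1F * X 2F) regular₄ (vanishes x₁=x₂ γ₃ γ₃∈Γ decide₃)
    (divide-cofactor x₃=0 (X 0F * X 1F) regular₃ (vanishes x₃=0 γ₂ γ₂∈Γ decide₃)
    (divide-cofactor x₂=0 (X 0F) regular₂ (vanishes x₂=0 γ-w γ-w∈Γ decide₃)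
    (divide x₁=0 f (vanishes x₁=0 γ-j γ-j∈Γ decide₃)))))))
  where
  conclude : ∃[ r ] f ≋ r * f₆₋ → f₆₋ ∣ f
  conclude (r , f≋) = record { quotient = r ; equality = ≋⇒≈ (≋.sym f≋) }

  vanishes : ∀ P γ → Γ γ → HalfTurn P (A₀ · γ) → restrict P f ≋ []
  vanishes = restrict-minus A₀ A₀·ρ⁻¹∈Γ {R} {l} {f} f∈ℋ

  regular₂ : Regular (restrict x₂=0 (X 0F))
  regular₂ = regular-cong {X 0F} decide (regular-X 0F)

  regular₃ : Regular (restrict x₃=0 (X 0F * X 1F))
  regular₃ = regular-cong {X 0F * X 1F} decide (regular-* {X 0F} {X 1F} (regular-X 0F) (regular-X 1F))

  regular₄ : Regular (restrict x₁=x₂ (X 0F * X 1F * X 2F))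
  regular₄ = regular-cong {X 0F * X 0F * X 2F} decide
    (regular-* {X 0F * X 0F} {X 2F} (regular-* {X 0F} {X 0F} (regular-X 0F) (regular-X 0F)) (regular-X 2F))

  regular₅ : Regular (restrict x₂=x₃ (X 0F * X 1F * X 2F * (X 0F - X 1F)))
  regular₅ = regular-cong {X 0F * X 1F * X 1F * (X 0F - X 1F)} decide
    (regular-* {X 0F * X 1F * X 1F} {X 0F - X 1F} (regular-* {X 0F * X 1F} {X 1F}
      (regular-* {X 0F} {X 1F} (regular-X 0F) (regular-X 1F)) (regular-X 1F)) regular-X₀-X₁)

  regular₆ : Regular (restrict x₃=x₁ (X 0F * X 1F * X 2F * (X 0F - X 1F) * (X 1F - X 2F)))
  -- On x₃ = x₁ the factor x₂ - x₃ becomes -(x₁ - x₂), hence the repeated factor and the constant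
  -- -1.
  regular₆ = regular-cong {X 0F * X 1F * X 0F * (X 0F - X 1F) * (X 0F - X 1F) * C (ℚ.- 1ℚ)} decide
    (regular-* {X 0F * X 1F * X 0F * (X 0F - X 1F) * (X 0F - X 1F)} {C (ℚ.- 1ℚ)}
      (regular-* {X 0F * X 1F * X 0F * (X 0F - X 1F)} {X 0F - X 1F}
        (regular-* {X 0F * X 1F * X 0F} {X 0F - X 1F} (regular-* {X 0F * X 1F} {X 0F}
          (regular-* {X 0F} {X 1F} (regular-X 0F) (regular-X 1F)) (regular-X 0F)) regular-X₀-X₁)
        regular-X₀-X₁)
      (regular-C (ℚ.- 1ℚ)))

proposition7 : (∀ (l : ℕ) → (∃[ k ] l ≡ 2 ℕ.* k ℕ.+ 1) → ∀ (f : Poly) → ℋ^Γ l f → f₃₊ ∣ f)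
    × (∀ (R : Transversal Γ 𝔗₂) (l : ℕ) (f : Poly) → ℋ^Γ₋ R l f → f₆₋ ∣ f)
proposition7 = (λ l odd f f∈ℋ → f₃₊-divides {l} {f} odd f∈ℋ) , (λ R l f f∈ℋ → f₆₋-divides {R} {l} {f} f∈ℋ)
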